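{- Assume the Continuum Hypothesis. Then for every real number $s \in (0,1]$ there exists a Hamel basis $B$ of $\mathbb{R}$ over $\mathbb{Q}$ (that is, a subset $B \subseteq \mathbb{R}$ that is linearly independent over $\mathbb{Q}$ and whose $\mathbb{Q}$-linear span is all of $\mathbb{R}$) such that the Hausdorff dimension of $B$ satisfies $\dim_H(B) = s$.
   Context: The Continuum Hypothesis is the statement $|\mathcal{P}(\mathbb{N})| = |\mathbb{R}| = \aleph_1$, i.e., the continuum has the cardinality of the first uncountable ordinal $\omega_1$. The axiom of choice (ZFC) is assumed. $\dim_H$ denotes the Hausdorff dimension of a subset of $\mathbb{R}$. -}

module Defs where

open import Algebra.Bundles using (CommutativeRing)
import Algebra.Definitions.RawMonoid as RawMonoidDefs
import Algebra.Properties.Semiring.Exp as SemiringExp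
open import Data.Fin.Base using (Fin)
open import Data.Integer.Base using (ℤ; +_; -[1+_]; ∣_∣)
open import Data.Nat.Base using (ℕ; zero; suc)
open import Data.Product.Base using (Σ-syntax; ∃; ∃-syntax; _×_; proj₁)
open import Data.Rational.Base using (ℚ; 0ℚ; NonNegative; ↥_; ↧_; ↧ₙ_)
open import Data.Sum.Base using ([_,_]′)
open import Function.Base using (const)
open import Function.Bundles using (Bijection; Func; Injection)
open import Function.Definitions using (Injective)
open import Induction.WellFounded using (WellFounded)
open import Level using (0ℓ; _⊔_) renaming (suc to lsuc)
open import Relation.Binary.Bundles using (Setoid; StrictTotalOrder)
open import Relation.Binary.Core using (Rel; REL)
import Relation.Binary.Construct.NonStrictToStrict as NonStrictToStrict
import Relation.Binary.Construct.On as On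
open import Relation.Binary.Definitions using (_Respects_; _Respectsˡ_; _Respectsʳ_)
open import Relation.Binary.PropositionalEquality.Core using (_≡_)
open import Relation.Binary.PropositionalEquality.Properties using () renaming (setoid to ≡-setoid)
open import Relation.Binary.Structures using (IsTotalOrder)
open import Relation.Nullary.Negation.Core using (¬_)
open import Relation.Unary using (Pred; _∈_; _⊆_; ⋃)
open import Relation.Unary.Relation.Binary.Equality using (≐-setoid)

-- Sets are represented by setoids, so the set-theoretic axiom of choice is
-- the assertion that every total relation between setoids contains (the
-- graph of) an equality-preserving function; for types with _≡_ it would
-- hold trivially.
AxiomOfChoice : ∀ a b r → Set (lsuc (a ⊔ b ⊔ r))
AxiomOfChoice a b r =
  (A : Setoid a a) (B : Setoid b b) →
  let module A = Setoid A ; module B = Setoid B in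
  (R : REL A.Carrier B.Carrier r) →
  R Respectsˡ A._≈_ → R Respectsʳ B._≈_ →
  (∀ x → ∃[ y ] R x y) →
  Σ[ f ∈ Func A B ] (∀ x → R x (Func.to f x))

module _ {a ℓ} {A : Set a} (_≤_ : Rel A ℓ) where

  IsUpperBound : ∀ {p} → Pred A p → A → Set (a ⊔ ℓ ⊔ p)
  IsUpperBound P u = ∀ x → x ∈ P → x ≤ u

  IsLowerBound : ∀ {p} → Pred A p → A → Set (a ⊔ ℓ ⊔ p)
  IsLowerBound P l = ∀ x → x ∈ P → l ≤ x

  IsSupremum : ∀ {p} → Pred A p → A → Set (a ⊔ ℓ ⊔ p)
  IsSupremum P s = IsUpperBound P s × (∀ u → IsUpperBound P u → s ≤ u)

  IsInfimum : ∀ {p} → Pred A p → A → Set (a ⊔ ℓ ⊔ p)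
  IsInfimum P i = IsLowerBound P i × (∀ l → IsLowerBound P l → l ≤ i)

-- The real numbers, characterised up to isomorphism as a Dedekind-complete
-- ordered field.  The value of 0# ⁻¹ is unspecified and never used below.
record RealField : Set₁ where
  infix  4 _≤_
  infix  8 _⁻¹
  field
    commutativeRing : CommutativeRing 0ℓ 0ℓ
  open CommutativeRing commutativeRing public
  field
    _≤_          : Rel Carrier 0ℓ
    _⁻¹          : Carrier → Carrier
    isTotalOrder : IsTotalOrder _≈_ _≤_
    0≉1          : ¬ (0# ≈ 1#)
    ⁻¹-cong      : ∀ {x y} → x ≈ y → x ⁻¹ ≈ y ⁻¹
    ⁻¹-inverseʳ  : ∀ x → ¬ (x ≈ 0#) → x * x ⁻¹ ≈ 1#
    +-monoˡ-≤    : ∀ z {x y} → x ≤ y → x + z ≤ y + z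
    *-nonNeg     : ∀ {x y} → 0# ≤ x → 0# ≤ y → 0# ≤ x * y
    complete     : (P : Pred Carrier 0ℓ) → ∃ P → ∃ (IsUpperBound _≤_ P) →
                   ∃ (IsSupremum _≤_ P)
  module ≤ = IsTotalOrder isTotalOrder

  open NonStrictToStrict _≈_ _≤_ public using (_<_)

Countable : ∀ {a ℓ} → Setoid a ℓ → Set (a ⊔ ℓ)
Countable S = Injection S (≡-setoid ℕ)

initialSegment : (W : StrictTotalOrder 0ℓ 0ℓ 0ℓ) → StrictTotalOrder.Carrier W → Setoid 0ℓ 0ℓ
initialSegment W a = On.setoid {B = Σ[ w ∈ W.Carrier ] w W.< a} W.Eq.setoid proj₁
  where module W = StrictTotalOrder W

-- W is a well-order isomorphic to ω₁.
record IsFirstUncountableOrdinal (W : StrictTotalOrder 0ℓ 0ℓ 0ℓ) : Set where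
  open StrictTotalOrder W
  field
    wellFounded : WellFounded _<_
    uncountable : ¬ Countable Eq.setoid
    countable-< : ∀ a → Countable (initialSegment W a)

module _ (ℝ : RealField) where
  open RealField ℝ
  open RawMonoidDefs +-rawMonoid using (sum) renaming (_×_ to _ℕ·_)
  open SemiringExp semiring using (_^_)

  -- |𝒫(ℕ)| = |ℝ| = ℵ₁
  ContinuumHypothesis : Set₁
  ContinuumHypothesis =
    Σ[ ω₁ ∈ StrictTotalOrder 0ℓ 0ℓ 0ℓ ]
      IsFirstUncountableOrdinal ω₁
      × Bijection (≐-setoid ℕ 0ℓ) setoid
      × Bijection setoid (StrictTotalOrder.Eq.setoid ω₁)

  fromℤ : ℤ → Carrier
  fromℤ (+ n)    = n ℕ· 1#
  fromℤ -[1+ n ] = - (suc n ℕ· 1#)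

  fromℚ : ℚ → Carrier
  fromℚ q = fromℤ (↥ q) * fromℤ (↧ q) ⁻¹

  linearCombination : ∀ {n} → (Fin n → ℚ) → (Fin n → Carrier) → Carrier
  linearCombination q v = sum (λ i → fromℚ (q i) * v i)

  LinearlyIndependent : Pred Carrier 0ℓ → Set
  LinearlyIndependent B =
    ∀ n (v : Fin n → Carrier) → Injective _≡_ _≈_ v → (∀ i → v i ∈ B) →
    (q : Fin n → ℚ) → linearCombination q v ≈ 0# → ∀ i → q i ≡ 0ℚ

  Spanning : Pred Carrier 0ℓ → Set
  Spanning B =
    ∀ x → ∃[ n ] Σ[ v ∈ (Fin n → Carrier) ] Σ[ q ∈ (Fin n → ℚ) ]
      (∀ i → v i ∈ B) × x ≈ linearCombination q v

  -- The first field says that the predicate B is a subset of the setoid of reals.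
  record IsHamelBasis (B : Pred Carrier 0ℓ) : Set where
    field
      respects-≈  : B Respects _≈_
      independent : LinearlyIndependent B
      spanning    : Spanning B

  abs : Carrier → Carrier
  abs x = [ const x , const (- x) ]′ (≤.total 0# x)

  -- RationalPower x q z: z = x^q, i.e. z is the non-negative b-th root of x^a
  -- for q = a / b ≥ 0.
  RationalPower : Carrier → ℚ → Carrier → Set
  RationalPower x q z = 0# ≤ z × z ^ ↧ₙ q ≈ x ^ ∣ ↥ q ∣

  RationalPowersBelow : Carrier → Carrier → Pred Carrier 0ℓ
  RationalPowersBelow x t z =
    ∃[ q ] NonNegative q × fromℚ q ≤ t × RationalPower x q z

  -- Power x t y: y = x^t, for real x, t ≥ 0.  The map q ↦ x^q is increasing
  -- for x ≥ 1 and decreasing for x ≤ 1.  In particular 0^0 = 1, and 0^t = 0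
  -- for t > 0.
  data Power (x t y : Carrier) : Set where
    power-≥1 : 1# ≤ x → IsSupremum _≤_ (RationalPowersBelow x t) y → Power x t y
    power-≤1 : 0# ≤ x → x ≤ 1# → IsInfimum _≤_ (RationalPowersBelow x t) y → Power x t y

  data [0,∞] : Set where
    fin : (x : Carrier) → 0# ≤ x → [0,∞]
    ∞   : [0,∞]

  infix 4 _≤∞_
  data _≤∞_ : Rel [0,∞] 0ℓ where
    fin≤fin : ∀ {x y p q} → x ≤ y → fin x p ≤∞ fin y q
    ≤∞-top  : ∀ {e} → e ≤∞ ∞

  +-nonNeg : ∀ {x y} → 0# ≤ x → 0# ≤ y → 0# ≤ x + y
  +-nonNeg {x} {y} 0≤x 0≤y =
    ≤.trans 0≤y (≤.trans (≤.reflexive (sym (+-identityˡ y))) (+-monoˡ-≤ y 0≤x))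

  0∞ : [0,∞]
  0∞ = fin 0# ≤.refl

  infixl 6 _+∞_
  _+∞_ : [0,∞] → [0,∞] → [0,∞]
  fin x p +∞ fin y q = fin (x + y) (+-nonNeg p q)
  fin _ _ +∞ ∞       = ∞
  ∞       +∞ _       = ∞

  partialSum : (ℕ → [0,∞]) → ℕ → [0,∞]
  partialSum c zero    = 0∞
  partialSum c (suc n) = partialSum c n +∞ c n

  -- From here on, the values of partial or classically defined functions are
  -- specified by relations whose last argument is the value; suprema and
  -- infima are taken in [0,∞], so that sup ∅ = 0 and inf ∅ = ∞.

  -- ∑ᵢ cᵢ
  IsSeriesSum : (ℕ → [0,∞]) → [0,∞] → Set
  IsSeriesSum c = IsSupremum _≤∞_ (λ e → ∃[ n ] e ≡ partialSum c n)

  -- diam U = sup { |x - y| : x, y ∈ U }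
  IsDiameter : Pred Carrier 0ℓ → [0,∞] → Set
  IsDiameter U = IsSupremum _≤∞_ λ e →
    ∃[ x ] ∃[ y ] x ∈ U × y ∈ U × ∃[ p ] e ≡ fin (abs (x - y)) p

  -- (diam U)^t for U of finite diameter, where the empty set contributes 0
  -- even when t = 0.
  IsDiameterPower : Pred Carrier 0ℓ → Carrier → [0,∞] → Set
  IsDiameterPower U t = IsSupremum _≤∞_ λ e →
    ∃ U × (∃[ d ] ∃[ 0≤d ] ∃[ z ] ∃[ 0≤z ]
      IsDiameter U (fin d 0≤d) × Power d t z × e ≡ fin z 0≤z)

  -- U is a countable cover of E by sets of diameter at most δ.
  IsCover : Pred Carrier 0ℓ → Carrier → (ℕ → Pred Carrier 0ℓ) → Set
  IsCover E δ U =
    E ⊆ ⋃ ℕ U × (∀ i → ∃[ d ] ∃[ 0≤d ] IsDiameter (U i) (fin d 0≤d) × d ≤ δ)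

  -- ℋᵗ_δ(E) = inf { ∑ᵢ (diam Uᵢ)^t : (Uᵢ) a δ-cover of E }
  IsHausdorffPremeasure : Pred Carrier 0ℓ → Carrier → Carrier → [0,∞] → Set₁
  IsHausdorffPremeasure E t δ = IsInfimum _≤∞_ λ e →
    Σ[ U ∈ (ℕ → Pred Carrier 0ℓ) ] Σ[ c ∈ (ℕ → [0,∞]) ]
      IsCover E δ U × (∀ i → IsDiameterPower (U i) t (c i)) × IsSeriesSum c e

  -- ℋᵗ(E) = sup { ℋᵗ_δ(E) : δ > 0 }, which is also the limit as δ → 0
  IsHausdorffMeasure : Pred Carrier 0ℓ → Carrier → [0,∞] → Set₁
  IsHausdorffMeasure E t = IsSupremum _≤∞_ λ e →
    ∃[ δ ] 0# < δ × IsHausdorffPremeasure E t δ e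

  -- dim_H E = inf { t ≥ 0 : ℋᵗ(E) = 0 }
  IsHausdorffDimension : Pred Carrier 0ℓ → [0,∞] → Set₁
  IsHausdorffDimension E = IsInfimum _≤∞_ λ e →
    ∃[ t ] ∃[ 0≤t ] IsHausdorffMeasure E t 0∞ × e ≡ fin t 0≤t

{-# OPTIONS --safe #-}

-- Let A ⊆ ℕ contain ⌊s n⌋ of the first n numbers for every n, and let E be
-- the set of reals in [0, 1] whose binary digits vanish outside A.  Covering E
-- by 2^⌊s n⌋ dyadic intervals of length 2⁻ⁿ gives dim E ≤ s.  Since A has
-- bounded gaps, every real is a rational combination of elements of E, so a
-- greedy selection yields a Hamel basis B ⊆ E.  To keep the dimension of B from
-- dropping, B is selected from a sequence indexed by ω₁: by CH the countable
-- unions of binary cylinders are also indexed by ω₁, and the w-th point is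
-- taken in E, outside the w-th union and outside the (countable) span of the
-- earlier points.  Such a point exists as soon as the total mass of the
-- cylinders is less than 1, where a cylinder of length n has mass 2^-⌊s n⌋;
-- and a cover of B with a small t-sum, t ≤ s, would produce a union of this
-- kind containing B.
module Submission where

open import Defs
open import Axiom.ExcludedMiddle using (ExcludedMiddle)
open import Data.Product.Base using (Σ-syntax; _×_; proj₁)
open import Level using (0ℓ)
open import Relation.Unary using (Pred)

open import Algebra.Solver.Ring.AlmostCommutativeRing using (fromCommutativeRing; _-Raw-AlmostCommutative⟶_)
import Algebra.Solver.Ring as RingSolver
open import Data.Bool.Base using (Bool; true; false; _∧_; not)
open import Data.Empty using (⊥; ⊥-elim)
open import Data.Fin.Base using (Fin; zero; suc; punchIn; punchOut)
import Data.Fin.Properties as Fin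
open import Data.Integer.Base as ℤ using (ℤ; +_; -[1+_])
import Data.Integer.GCD as ℤ
import Data.Integer.Properties as ℤ
open import Data.List.Base as List using (List; []; _∷_; _++_; length)
open import Data.List.Membership.Propositional using (lose) renaming (_∈_ to _∈ˡ_)
open import Data.List.Membership.Propositional.Properties using (∈-map⁺; ∈-upTo⁺; ∈-concatMap⁺; ∈-++⁺ˡ; ∈-++⁺ʳ)
open import Data.List.Properties using (∷-injective; ∷-injectiveʳ)
open import Data.List.Relation.Unary.Any using (here; there)
open import Data.Maybe.Base using (Maybe; just; nothing)
open import Data.Nat.Base as ℕ using (ℕ; zero; suc; z≤n; s≤s)
import Data.Nat.Properties as ℕ
open import Data.Nat.Solver using () renaming (module +-*-Solver to ℕ-Solver)
open import Data.Product.Base using (∃; ∃-syntax; _,_; proj₂)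
open import Data.Rational.Base as ℚ using (ℚ; mkℚ; 0ℚ; 1ℚ; ↥_; ↧_; ↧ₙ_)
import Data.Rational.Properties as ℚ
open import Data.Sum.Base using (_⊎_; inj₁; inj₂; [_,_]′)
open import Data.Sum.Relation.Binary.LeftOrder using (⊎-<-strictTotalOrder; ⊎-<-wellFounded; ₁∼₁)
open import Data.Sum.Relation.Binary.Pointwise using (inj₁; inj₂)
open import Data.Unit.Base using (⊤; tt)
import Data.Vec.Functional as Vector
open import Function.Base using (_∘_)
open import Function.Bundles using (Bijection; Func; Injection)
open import Induction.WellFounded using (WellFounded; Acc; acc)
open import Level using (Lift; lift) renaming (suc to lsuc)
open import Relation.Binary.Bundles using (Setoid; StrictTotalOrder)
open import Relation.Binary.Definitions using (_Respects_; tri<; tri≈; tri>)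
open import Relation.Binary.PropositionalEquality as ≡ using (_≡_)
open import Relation.Nullary using (¬_; Dec; yes; no; does)
open import Relation.Nullary.Decidable using (True; toWitness; fromWitness)
open import Relation.Unary using (_⊆_; _∈_; _≐_; ⋃)
open import Relation.Unary.Properties using (≐-refl; ≐-sym; ≐-trans)

-- Binary digit sequences

-- The well-order for the greedy selection is ω₁ + ω₁. The chosen points come first, so independence
-- of the earlier points alone gets a point selected; all elements of E follow and secure spanning.
-- Initial segments of ω₁ are countable, which makes a span affordable: its elements are enclosed in
-- cylinders so long that together they weigh less than 1/2, leaving 1/2 for the union to be
-- avoided. Arbitrary covering sets are replaced by cylinders through their dyadic scale. Prefixes
-- of length n of two points at distance at most 2⁻ⁿ differ, as integers, by at most 2, so five
-- cylinders suffice; passing from the exponent t to the mass loses a factor 4. A t-sum of at most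
-- 2⁻⁷ pays for both losses. Since sets are setoids, the points must depend on an element of ω₁ only
-- up to its equality. This is why choice is used through one extensional operator on predicates.

Digits : Set
Digits = ℕ → Bool

bit : Bool → ℕ
bit false = 0
bit true  = 1

-- The integer with binary expansion d 0 … d (n - 1), most significant digit first.
leading : Digits → ℕ → ℕ
leading d zero    = 0
leading d (suc n) = (leading d n ℕ.+ leading d n) ℕ.+ bit (d n)

count : Digits → ℕ → ℕ
count A zero    = 0
count A (suc n) = count A n ℕ.+ bit (A n)

SupportedOn : Digits → Digits → Set
SupportedOn A d = ∀ n → d n ≡ true → A n ≡ true

segment : ℕ → ℕ → Digits → List Bool
segment m zero    d = []
segment m (suc n) d = d m ∷ segment (suc m) n d

OccursAt : ℕ → List Bool → Digits → Set
OccursAt m []      d = ⊤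
OccursAt m (b ∷ τ) d = d m ≡ b × OccursAt (suc m) τ d

length-segment : ∀ m n d → length (segment m n d) ≡ n
length-segment m zero    d = ≡.refl
length-segment m (suc n) d = ≡.cong suc (length-segment (suc m) n d)

segment-occurs : ∀ m n {d e} → (∀ i → m ℕ.≤ i → i ℕ.< m ℕ.+ n → d i ≡ e i) → OccursAt m (segment m n e) d
segment-occurs m zero    d≡e = tt
segment-occurs m (suc n) d≡e =
  d≡e m ℕ.≤-refl (ℕ.m<m+n m (s≤s z≤n)) ,
  segment-occurs (suc m) n λ i m<i i< → d≡e i (ℕ.<⇒≤ m<i) (≡.subst (i ℕ.<_) (≡.sym (ℕ.+-suc m n)) i<)

bit-unique : ∀ x y a b → (x ℕ.+ x) ℕ.+ bit a ≡ (y ℕ.+ y) ℕ.+ bit b → x ≡ y × a ≡ b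
bit-unique zero    zero    false false eq = ≡.refl , ≡.refl
bit-unique zero    zero    true  true  eq = ≡.refl , ≡.refl
bit-unique (suc x) zero    a     true  eq with ≡.trans (≡.cong (ℕ._+ bit a) (≡.sym (ℕ.+-suc x x))) (ℕ.suc-injective eq)
... | ()
bit-unique zero    (suc y) true  b     eq with ≡.trans (ℕ.suc-injective eq) (≡.cong (ℕ._+ bit b) (ℕ.+-suc y y))
... | ()
bit-unique (suc x) (suc y) a     b     eq rewrite ℕ.+-suc x x | ℕ.+-suc y y
  with bit-unique x y a b (ℕ.suc-injective (ℕ.suc-injective eq))
... | x≡y , a≡b = ≡.cong suc x≡y , a≡b

leading-injective : ∀ {d e} n → leading d n ≡ leading e n → ∀ i → i ℕ.< n → d i ≡ e i
leading-injective {d} {e} (suc n) eq i (s≤s i≤n) with bit-unique (leading d n) (leading e n) (d n) (e n) eq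
... | eq′ , dn≡en with ℕ.m≤n⇒m<n∨m≡n i≤n
...   | inj₁ i<n    = leading-injective n eq′ i i<n
...   | inj₂ ≡.refl = dn≡en

-- The digitwise hypothesis excludes carries.
leading-+ : ∀ {d d₁ d₂} → (∀ i → bit (d i) ≡ bit (d₁ i) ℕ.+ bit (d₂ i)) →
            ∀ n → leading d n ≡ leading d₁ n ℕ.+ leading d₂ n
leading-+ eq zero = ≡.refl
leading-+ {d} {d₁} {d₂} eq (suc n) rewrite leading-+ {d} {d₁} {d₂} eq n | eq n =
  rearrange (leading d₁ n) (leading d₂ n) (bit (d₁ n)) (bit (d₂ n))
  where
  open ℕ-Solver
  rearrange : ∀ a b c e → (a ℕ.+ b) ℕ.+ (a ℕ.+ b) ℕ.+ (c ℕ.+ e) ≡ ((a ℕ.+ a) ℕ.+ c) ℕ.+ ((b ℕ.+ b) ℕ.+ e)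
  rearrange = solve 4 (λ a b c e → (a :+ b) :+ (a :+ b) :+ (c :+ e) := ((a :+ a) :+ c) :+ ((b :+ b) :+ e)) ≡.refl

shift : Digits → Digits
shift d zero    = false
shift d (suc n) = d n

leading-shift : ∀ d n → leading (shift d) (suc n) ≡ leading d n
leading-shift d zero    = ≡.refl
leading-shift d (suc n) = ≡.cong (λ x → (x ℕ.+ x) ℕ.+ bit (d n)) (leading-shift d n)

_⊓ᵈ_ _∖ᵈ_ : Digits → Digits → Digits
(d ⊓ᵈ A) n = d n ∧ A n
(d ∖ᵈ A) n = d n ∧ not (A n)

bit-split : ∀ x y → bit x ≡ bit (x ∧ y) ℕ.+ bit (x ∧ not y)
bit-split false y     = ≡.refl
bit-split true  false = ≡.refl
bit-split true  true  = ≡.refl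

-- The Brzozowski derivative of a finite set of words. Dropping the empty word is harmless: it has
-- weight 1, so a family of total weight below 1 never contains it.
derivative : Bool → List (List Bool) → List (List Bool)
derivative c []                     = []
derivative c ([] ∷ cs)              = derivative c cs
derivative false ((false ∷ τ) ∷ cs) = τ ∷ derivative false cs
derivative false ((true  ∷ τ) ∷ cs) = derivative false cs
derivative true  ((false ∷ τ) ∷ cs) = derivative true cs
derivative true  ((true  ∷ τ) ∷ cs) = τ ∷ derivative true cs

derivative-++ : ∀ c cs cs′ → derivative c (cs ++ cs′) ≡ derivative c cs ++ derivative c cs′
derivative-++ c     []                   cs′ = ≡.refl
derivative-++ c     ([] ∷ cs)            cs′ = derivative-++ c cs cs′
derivative-++ false ((false ∷ τ) ∷ cs)   cs′ = ≡.cong (τ ∷_) (derivative-++ false cs cs′)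
derivative-++ false ((true  ∷ τ) ∷ cs)   cs′ = derivative-++ false cs cs′
derivative-++ true  ((false ∷ τ) ∷ cs)   cs′ = derivative-++ true cs cs′
derivative-++ true  ((true  ∷ τ) ∷ cs)   cs′ = ≡.cong (τ ∷_) (derivative-++ true cs cs′)

∈-derivative : ∀ b {τ cs} → (b ∷ τ) ∈ˡ cs → τ ∈ˡ derivative b cs
∈-derivative false (here ≡.refl) = here ≡.refl
∈-derivative true  (here ≡.refl) = here ≡.refl
∈-derivative false {cs = []            ∷ cs} (there i) = ∈-derivative false i
∈-derivative false {cs = (false ∷ _)   ∷ cs} (there i) = there (∈-derivative false i)
∈-derivative false {cs = (true  ∷ _)   ∷ cs} (there i) = ∈-derivative false i
∈-derivative true  {cs = []            ∷ cs} (there i) = ∈-derivative true i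
∈-derivative true  {cs = (false ∷ _)   ∷ cs} (there i) = ∈-derivative true i
∈-derivative true  {cs = (true  ∷ _)   ∷ cs} (there i) = there (∈-derivative true i)

-- Codes of words, lists and rational terms; prefixes permitted by a digit set

encodeBits : List Bool → ℕ
encodeBits []          = 0
encodeBits (false ∷ τ) = suc (encodeBits τ ℕ.+ encodeBits τ)
encodeBits (true  ∷ τ) = suc (suc (encodeBits τ ℕ.+ encodeBits τ))

-- `encodeBits` is bijective base 2: the digits 1 and 2 instead of 0 and 1 keep words apart that
-- differ only in trailing `false`s.
encodeBits-injective : ∀ σ τ → encodeBits σ ≡ encodeBits τ → σ ≡ τ
encodeBits-injective []      []      eq = ≡.refl
encodeBits-injective []      (false ∷ τ) ()
encodeBits-injective []      (true ∷ τ) ()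
encodeBits-injective (false ∷ σ) [] ()
encodeBits-injective (true ∷ σ) [] ()
encodeBits-injective (a ∷ σ) (b ∷ τ) eq
  with bit-unique (encodeBits σ) (encodeBits τ) a b
         (ℕ.suc-injective (≡.trans (≡.sym (unfold a σ)) (≡.trans eq (unfold b τ))))
  where
  unfold : ∀ b τ → encodeBits (b ∷ τ) ≡ suc ((encodeBits τ ℕ.+ encodeBits τ) ℕ.+ bit b)
  unfold false τ = ≡.cong suc (≡.sym (ℕ.+-identityʳ _))
  unfold true  τ = ≡.cong suc (≡.sym (ℕ.+-comm _ 1))
... | eq′ , ≡.refl = ≡.cong (a ∷_) (encodeBits-injective σ τ eq′)

-- Each entry is a block of `true`s closed by a `false`, so the concatenation is uniquely decodable.
unary : List ℕ → List Bool
unary []           = []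
unary (zero ∷ ns)  = false ∷ unary ns
unary (suc n ∷ ns) = true ∷ unary (n ∷ ns)

unary-injective : ∀ ms ns → unary ms ≡ unary ns → ms ≡ ns
unary-injective []           []           eq = ≡.refl
unary-injective []           (zero ∷ ns)  ()
unary-injective []           (suc n ∷ ns) ()
unary-injective (zero ∷ ms)  []           ()
unary-injective (suc m ∷ ms) []           ()
unary-injective (zero ∷ ms)  (zero ∷ ns)  eq = ≡.cong (0 ∷_) (unary-injective ms ns (∷-injectiveʳ eq))
unary-injective (zero ∷ ms)  (suc n ∷ ns) ()
unary-injective (suc m ∷ ms) (zero ∷ ns)  ()
unary-injective (suc m ∷ ms) (suc n ∷ ns) eq with unary-injective (m ∷ ms) (n ∷ ns) (∷-injectiveʳ eq)
... | ≡.refl = ≡.refl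

children : Bool → ℕ → List ℕ
children false l = (l ℕ.+ l) ℕ.+ 0 ∷ []
children true  l = (l ℕ.+ l) ℕ.+ 0 ∷ (l ℕ.+ l) ℕ.+ 1 ∷ []

leadings : Digits → ℕ → List ℕ
leadings A zero    = 0 ∷ []
leadings A (suc n) = List.concatMap (children (A n)) (leadings A n)

length-children : ∀ b ls → length (List.concatMap (children b) ls) ≡ 2 ℕ.^ bit b ℕ.* length ls
length-children b []       = ≡.sym (ℕ.*-zeroʳ (2 ℕ.^ bit b))
length-children false (l ∷ ls) = ≡.cong suc (length-children false ls)
length-children true  (l ∷ ls) = ≡.trans (≡.cong (2 ℕ.+_) (length-children true ls)) (≡.sym (ℕ.*-suc 2 (length ls)))

length-leadings : ∀ A n → length (leadings A n) ≡ 2 ℕ.^ count A n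
length-leadings A zero    = ≡.refl
length-leadings A (suc n) = ≡.trans (length-children (A n) (leadings A n))
  (≡.trans (≡.cong (2 ℕ.^ bit (A n) ℕ.*_) (length-leadings A n))
  (≡.trans (ℕ.*-comm (2 ℕ.^ bit (A n)) (2 ℕ.^ count A n)) (≡.sym (ℕ.^-distribˡ-+-* 2 (count A n) (bit (A n))))))

leading∈leadings : ∀ {A d} → SupportedOn A d → ∀ n → leading d n ∈ˡ leadings A n
leading∈leadings supp zero = here ≡.refl
leading∈leadings {A} {d} supp (suc n) = ∈-concatMap⁺ (children (A n)) (lose (leading∈leadings supp n) (child (A n) (d n) (supp n)))
  where
  child : ∀ a b → (b ≡ true → a ≡ true) → (leading d n ℕ.+ leading d n) ℕ.+ bit b ∈ˡ children a (leading d n)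
  child false false _ = here ≡.refl
  child true  false _ = here ≡.refl
  child true  true  _ = there (here ≡.refl)
  child false true  f with f ≡.refl
  ... | ()

member-between : ∀ A n k → count A n ℕ.< count A (n ℕ.+ k) → ∃[ j ] j ℕ.< k × A (n ℕ.+ j) ≡ true
member-between A n zero lt = ⊥-elim (ℕ.<-irrefl (≡.cong (count A) (≡.sym (ℕ.+-identityʳ n))) lt)
member-between A n (suc k) lt = go (A (n ℕ.+ k)) ≡.refl
  where
  go : ∀ b → A (n ℕ.+ k) ≡ b → ∃[ j ] j ℕ.< suc k × A (n ℕ.+ j) ≡ true
  go true  eq = k , ℕ.n<1+n k , eq
  go false eq = let j , j<k , Aj = member-between A n k (≡.subst (count A n ℕ.<_) same lt) in j , ℕ.m<n⇒m<1+n j<k , Aj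
    where
    same : count A (n ℕ.+ suc k) ≡ count A (n ℕ.+ k)
    same = ≡.trans (≡.cong (count A) (ℕ.+-suc n k)) (≡.trans (≡.cong (λ b → count A (n ℕ.+ k) ℕ.+ bit b) eq) (ℕ.+-identityʳ _))

encodeTerms : List (ℚ × ℕ) → List ℕ
encodeTerms []                           = []
encodeTerms ((mkℚ (+ n)    d _ , i) ∷ ts) = 0 ∷ n ∷ d ∷ i ∷ encodeTerms ts
encodeTerms ((mkℚ -[1+ n ] d _ , i) ∷ ts) = 1 ∷ n ∷ d ∷ i ∷ encodeTerms ts

encodeTerms-injective : ∀ ss ts → encodeTerms ss ≡ encodeTerms ts → ss ≡ ts
encodeTerms-injective [] [] eq = ≡.refl
encodeTerms-injective [] ((mkℚ (+ _) _ _ , _) ∷ _) ()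
encodeTerms-injective [] ((mkℚ -[1+ _ ] _ _ , _) ∷ _) ()
encodeTerms-injective ((mkℚ (+ _) _ _ , _) ∷ _) [] ()
encodeTerms-injective ((mkℚ -[1+ _ ] _ _ , _) ∷ _) [] ()
encodeTerms-injective ((mkℚ (+ _) _ _ , _) ∷ _) ((mkℚ -[1+ _ ] _ _ , _) ∷ _) ()
encodeTerms-injective ((mkℚ -[1+ _ ] _ _ , _) ∷ _) ((mkℚ (+ _) _ _ , _) ∷ _) ()
encodeTerms-injective ((mkℚ (+ m) d c , i) ∷ ss) ((mkℚ (+ n) e _ , j) ∷ ts) eq
  with ∷-injective eq
... | _ , eq₁ with ∷-injective eq₁
... | ≡.refl , eq₂ with ∷-injective eq₂
... | ≡.refl , eq₃ with ∷-injective eq₃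
... | ≡.refl , eq₄ = ≡.cong ((mkℚ (+ m) d c , i) ∷_) (encodeTerms-injective ss ts eq₄)
encodeTerms-injective ((mkℚ -[1+ m ] d c , i) ∷ ss) ((mkℚ -[1+ n ] e _ , j) ∷ ts) eq
  with ∷-injective eq
... | _ , eq₁ with ∷-injective eq₁
... | ≡.refl , eq₂ with ∷-injective eq₂
... | ≡.refl , eq₃ with ∷-injective eq₃
... | ≡.refl , eq₄ = ≡.cong ((mkℚ -[1+ m ] d c , i) ∷_) (encodeTerms-injective ss ts eq₄)

-- Arithmetic in a Dedekind-complete ordered field

module Development (lem : ∀ ℓ → ExcludedMiddle ℓ) (ℝ : RealField) where

  open RealField ℝ renaming (zero to *-zero)
  open import Algebra.Properties.Semiring.Mult semiring
    using (×-homo-+; ×1-homo-*; ×-congˡ) renaming (_×_ to _ℕ·_)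
  import Algebra.Properties.Monoid.Mult.TCOptimised +-monoid as TCOptimised
  open import Algebra.Definitions.RawMonoid +-rawMonoid using (_×′_)
  open import Algebra.Properties.Semiring.Exp semiring
  open import Algebra.Properties.Ring ring using (-‿distribˡ-*; -‿distribʳ-*; -0#≈0#; -‿involutive)
  open import Algebra.Properties.AbelianGroup +-abelianGroup using (⁻¹-∙-comm)
  open import Relation.Binary.Reasoning.Setoid setoid

  dec : ∀ {ℓ} (P : Set ℓ) → Dec P
  dec P = lem _

  ι : ℕ → Carrier
  ι n = n ℕ· 1#

  fromℤ-⊖ : ∀ m n → fromℤ ℝ (m ℤ.⊖ n) ≈ ι m - ι n
  fromℤ-⊖ m zero = sym (trans (+-congˡ -0#≈0#) (+-identityʳ _))
  fromℤ-⊖ zero (suc n) = sym (+-identityˡ _)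
  fromℤ-⊖ (suc m) (suc n) = begin
    fromℤ ℝ (suc m ℤ.⊖ suc n)         ≈⟨ reflexive (≡.cong (fromℤ ℝ) (ℤ.[1+m]⊖[1+n]≡m⊖n m n)) ⟩
    fromℤ ℝ (m ℤ.⊖ n)                 ≈⟨ fromℤ-⊖ m n ⟩
    ι m - ι n                         ≈⟨ +-congˡ (+-identityˡ _) ⟨
    ι m + (0# - ι n)                  ≈⟨ +-congˡ (+-congʳ (-‿inverseʳ 1#)) ⟨
    ι m + ((1# - 1#) - ι n)           ≈⟨ +-congˡ (+-assoc _ _ _) ⟩
    ι m + (1# + (- 1# - ι n))         ≈⟨ +-assoc _ _ _ ⟨
    (ι m + 1#) + (- 1# - ι n)         ≈⟨ +-cong (+-comm _ _) (⁻¹-∙-comm 1# (ι n)) ⟩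
    (1# + ι m) - (1# + ι n)           ∎

  fromℤ-neg : ∀ i → fromℤ ℝ (ℤ.- i) ≈ - fromℤ ℝ i
  fromℤ-neg (+ zero)  = sym -0#≈0#
  fromℤ-neg (+ suc n) = refl
  fromℤ-neg -[1+ n ]  = sym (-‿involutive _)

  fromℤ-+ : ∀ i j → fromℤ ℝ (i ℤ.+ j) ≈ fromℤ ℝ i + fromℤ ℝ j
  fromℤ-+ (+ m)    (+ n)    = ×-homo-+ 1# m n
  fromℤ-+ (+ m)    -[1+ n ] = fromℤ-⊖ m (suc n)
  fromℤ-+ -[1+ m ] (+ n)    = trans (fromℤ-⊖ n (suc m)) (+-comm _ _)
  fromℤ-+ -[1+ m ] -[1+ n ] = begin
    - ι (suc (suc (m ℕ.+ n)))        ≈⟨ -‿cong (×-congˡ (ℕ.+-suc (suc m) n)) ⟨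
    - ι (suc m ℕ.+ suc n)            ≈⟨ -‿cong (×-homo-+ 1# (suc m) (suc n)) ⟩
    - (ι (suc m) + ι (suc n))        ≈⟨ ⁻¹-∙-comm _ _ ⟨
    - ι (suc m) - ι (suc n)          ∎

  fromℤ-pos-* : ∀ m j → fromℤ ℝ (+ m ℤ.* j) ≈ ι m * fromℤ ℝ j
  fromℤ-pos-* m (+ n) = begin
    fromℤ ℝ (+ m ℤ.* + n)            ≈⟨ reflexive (≡.cong (fromℤ ℝ) (ℤ.pos-* m n)) ⟨
    ι (m ℕ.* n)                      ≈⟨ ×1-homo-* m n ⟩
    ι m * ι n                        ∎
  fromℤ-pos-* m -[1+ n ] = begin
    fromℤ ℝ (+ m ℤ.* (ℤ.- + suc n))  ≈⟨ reflexive (≡.cong (fromℤ ℝ) (ℤ.neg-distribʳ-* (+ m) (+ suc n))) ⟨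
    fromℤ ℝ (ℤ.- (+ m ℤ.* + suc n))  ≈⟨ fromℤ-neg (+ m ℤ.* + suc n) ⟩
    - fromℤ ℝ (+ m ℤ.* + suc n)      ≈⟨ -‿cong (fromℤ-pos-* m (+ suc n)) ⟩
    - (ι m * ι (suc n))              ≈⟨ -‿distribʳ-* _ _ ⟩
    ι m * - ι (suc n)                ∎

  fromℤ-* : ∀ i j → fromℤ ℝ (i ℤ.* j) ≈ fromℤ ℝ i * fromℤ ℝ j
  fromℤ-* (+ m)    j = fromℤ-pos-* m j
  fromℤ-* -[1+ m ] j = begin
    fromℤ ℝ ((ℤ.- + suc m) ℤ.* j)    ≈⟨ reflexive (≡.cong (fromℤ ℝ) (ℤ.neg-distribˡ-* (+ suc m) j)) ⟨
    fromℤ ℝ (ℤ.- (+ suc m ℤ.* j))    ≈⟨ fromℤ-neg (+ suc m ℤ.* j) ⟩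
    - fromℤ ℝ (+ suc m ℤ.* j)        ≈⟨ -‿cong (fromℤ-pos-* (suc m) j) ⟩
    - (ι (suc m) * fromℤ ℝ j)        ≈⟨ -‿distribˡ-* _ _ ⟩
    (- ι (suc m)) * fromℤ ℝ j        ∎

  -- A variant of fromℤ sending 1 and 2 to 1# and 1# + 1# on the nose, so that
  -- numerals in solver equations match those in goals.
  coeff : ℤ → Carrier
  coeff (+ n)    = n ×′ 1#
  coeff -[1+ n ] = - (suc n ×′ 1#)

  coeff≈fromℤ : ∀ i → coeff i ≈ fromℤ ℝ i
  coeff≈fromℤ (+ n)    = sym (TCOptimised.×ᵤ≈× n 1#)
  coeff≈fromℤ -[1+ n ] = -‿cong (sym (TCOptimised.×ᵤ≈× (suc n) 1#))

  coeff-homomorphism : ℤ.+-*-rawRing -Raw-AlmostCommutative⟶ fromCommutativeRing commutativeRing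
  coeff-homomorphism = record
    { ⟦_⟧    = coeff
    ; +-homo = λ i j → trans (coeff≈fromℤ (i ℤ.+ j)) (trans (fromℤ-+ i j) (sym (+-cong (coeff≈fromℤ i) (coeff≈fromℤ j))))
    ; *-homo = λ i j → trans (coeff≈fromℤ (i ℤ.* j)) (trans (fromℤ-* i j) (sym (*-cong (coeff≈fromℤ i) (coeff≈fromℤ j))))
    ; -‿homo = λ i → trans (coeff≈fromℤ (ℤ.- i)) (trans (fromℤ-neg i) (sym (-‿cong (coeff≈fromℤ i))))
    ; 0-homo = refl
    ; 1-homo = refl
    }

  coeff-≟ : ∀ i j → Maybe (coeff i ≈ coeff j)
  coeff-≟ i j with i ℤ.≟ j
  ... | yes i≡j = just (reflexive (≡.cong coeff i≡j))
  ... | no _    = nothing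

  open RingSolver ℤ.+-*-rawRing (fromCommutativeRing commutativeRing) coeff-homomorphism coeff-≟
    using (solve; _:=_; _:+_; _:*_; _:-_; :-_; con)

  0≤y-x : ∀ {x y} → x ≤ y → 0# ≤ y - x
  0≤y-x {x} x≤y = ≤.≤-respˡ-≈ (-‿inverseʳ x) (+-monoˡ-≤ (- x) x≤y)

  -- A linear inequality is proved by exhibiting y - x as a non-negative
  -- combination of the hypotheses.
  ≤-certificate : ∀ {x y e} → 0# ≤ e → y - x ≈ e → x ≤ y
  ≤-certificate {x} {y} {e} 0≤e eq =
    ≤.≤-respˡ-≈ (+-identityˡ x) (≤.≤-respʳ-≈ (trans (+-congʳ (sym eq)) (solve 2 (λ a b → a :- b :+ b := a) refl y x)) (+-monoˡ-≤ x 0≤e))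

  infix 4 _≤?_
  _≤?_ : ∀ x y → Dec (x ≤ y)
  x ≤? y = dec (x ≤ y)

  ≰⇒≥ : ∀ {x y} → ¬ (x ≤ y) → y ≤ x
  ≰⇒≥ {x} {y} x≰y with ≤.total x y
  ... | inj₁ x≤y = ⊥-elim (x≰y x≤y)
  ... | inj₂ y≤x = y≤x

  <⇒≱ : ∀ {x y} → x < y → ¬ (y ≤ x)
  <⇒≱ (x≤y , x≉y) y≤x = x≉y (≤.antisym x≤y y≤x)

  ≰⇒> : ∀ {x y} → ¬ (x ≤ y) → y < x
  ≰⇒> x≰y = ≰⇒≥ x≰y , λ y≈x → x≰y (≤.reflexive (sym y≈x))

  +-mono-≤ : ∀ {a b c d} → a ≤ b → c ≤ d → a + c ≤ b + d
  +-mono-≤ {a} {b} {c} {d} a≤b c≤d = ≤-certificate (+-nonNeg ℝ (0≤y-x a≤b) (0≤y-x c≤d))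
    (solve 4 (λ a b c d → (b :+ d) :- (a :+ c) := (b :- a) :+ (d :- c)) refl a b c d)

  *-monoˡ-≤ : ∀ {a b} c → 0# ≤ c → a ≤ b → c * a ≤ c * b
  *-monoˡ-≤ {a} {b} c 0≤c a≤b = ≤-certificate (*-nonNeg 0≤c (0≤y-x a≤b))
    (solve 3 (λ a b c → (c :* b) :- (c :* a) := c :* (b :- a)) refl a b c)

  *-monoʳ-≤ : ∀ {a b} c → 0# ≤ c → a ≤ b → a * c ≤ b * c
  *-monoʳ-≤ {a} {b} c 0≤c a≤b = ≤.≤-respˡ-≈ (*-comm c a) (≤.≤-respʳ-≈ (*-comm c b) (*-monoˡ-≤ c 0≤c a≤b))

  *-mono-≤ : ∀ {a b c d} → 0# ≤ a → a ≤ b → 0# ≤ c → c ≤ d → a * c ≤ b * d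
  *-mono-≤ {a} {b} {c} {d} 0≤a a≤b 0≤c c≤d = ≤.trans (*-monoʳ-≤ c 0≤c a≤b) (*-monoˡ-≤ b (≤.trans 0≤a a≤b) c≤d)

  neg-mono-≤ : ∀ {x y} → x ≤ y → - y ≤ - x
  neg-mono-≤ {x} {y} x≤y = ≤-certificate (0≤y-x x≤y) (solve 2 (λ x y → (:- x) :- (:- y) := y :- x) refl x y)

  x≤x+y : ∀ {x y} → 0# ≤ y → x ≤ x + y
  x≤x+y {x} {y} 0≤y = ≤-certificate 0≤y (solve 2 (λ x y → (x :+ y) :- x := y) refl x y)

  +-cancelʳ-≤ : ∀ {x y} z → x + z ≤ y + z → x ≤ y
  +-cancelʳ-≤ {x} {y} z le = ≤-certificate (0≤y-x le) (solve 3 (λ x y z → y :- x := (y :+ z) :- (x :+ z)) refl x y z)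

  0≤1 : 0# ≤ 1#
  0≤1 with ≤.total 0# 1#
  ... | inj₁ 0≤1 = 0≤1
  ... | inj₂ 1≤0 = ≤.≤-respʳ-≈ (solve 0 ((:- con (+ 1)) :* (:- con (+ 1)) := con (+ 1)) refl) (*-nonNeg 0≤-1 0≤-1)
    where
    0≤-1 : 0# ≤ - 1#
    0≤-1 = ≤.≤-respˡ-≈ -0#≈0# (neg-mono-≤ 1≤0)

  0<1 : 0# < 1#
  0<1 = 0≤1 , 0≉1

  <-≤-trans : ∀ {x y z} → x < y → y ≤ z → x < z
  <-≤-trans (x≤y , x≉y) y≤z = ≤.trans x≤y y≤z , λ x≈z → x≉y (≤.antisym x≤y (≤.≤-respʳ-≈ (sym x≈z) y≤z))

  0<+ : ∀ {x y} → 0# < x → 0# ≤ y → 0# < x + y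
  0<+ 0<x 0≤y = <-≤-trans 0<x (x≤x+y 0≤y)

  >⇒≉0 : ∀ {x} → 0# < x → ¬ (x ≈ 0#)
  >⇒≉0 (_ , ne) x≈0 = ne (sym x≈0)

  0<x⇒0≤x⁻¹ : ∀ {x} → 0# < x → 0# ≤ x ⁻¹
  0<x⇒0≤x⁻¹ {x} 0<x with ≤.total 0# (x ⁻¹)
  ... | inj₁ 0≤ = 0≤
  ... | inj₂ ≤0 = ⊥-elim (<⇒≱ 0<1 (≤-certificate
      (*-nonNeg (proj₁ 0<x) (0≤y-x ≤0))
      (trans (+-congˡ (-‿cong (sym (⁻¹-inverseʳ x (>⇒≉0 0<x)))))
        (solve 2 (λ x y → con (+ 0) :- x :* y := x :* (con (+ 0) :- y)) refl x (x ⁻¹)))))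

  *-cancelˡ-≤ : ∀ {a b} c → 0# < c → c * a ≤ c * b → a ≤ b
  *-cancelˡ-≤ {a} {b} c 0<c ca≤cb = ≤.≤-respˡ-≈ (undo a) (≤.≤-respʳ-≈ (undo b) (*-monoˡ-≤ (c ⁻¹) (0<x⇒0≤x⁻¹ 0<c) ca≤cb))
    where
    undo : ∀ x → c ⁻¹ * (c * x) ≈ x
    undo x = begin
      c ⁻¹ * (c * x) ≈⟨ solve 3 (λ c d x → d :* (c :* x) := (c :* d) :* x) refl c (c ⁻¹) x ⟩
      (c * c ⁻¹) * x ≈⟨ *-congʳ (⁻¹-inverseʳ c (>⇒≉0 0<c)) ⟩
      1# * x         ≈⟨ *-identityˡ x ⟩
      x              ∎

  *-cancelʳ-≤ : ∀ {a b} c → 0# < c → a * c ≤ b * c → a ≤ b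
  *-cancelʳ-≤ {a} {b} c 0<c le = *-cancelˡ-≤ c 0<c (≤.≤-respˡ-≈ (*-comm a c) (≤.≤-respʳ-≈ (*-comm b c) le))

  0<* : ∀ {x y} → 0# < x → 0# < y → 0# < x * y
  0<* {x} {y} 0<x 0<y = *-nonNeg (proj₁ 0<x) (proj₁ 0<y) , λ 0≈xy →
    <⇒≱ 0<y (*-cancelˡ-≤ x 0<x (≤.reflexive (trans (sym 0≈xy) (sym (zeroʳ x)))))

  0≤ι : ∀ n → 0# ≤ ι n
  0≤ι zero    = ≤.refl
  0≤ι (suc n) = +-nonNeg ℝ 0≤1 (0≤ι n)

  0<ι : ∀ n → 0# < ι (suc n)
  0<ι n = 0<+ 0<1 (0≤ι n)

  ι-mono-≤ : ∀ {m n} → m ℕ.≤ n → ι m ≤ ι n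
  ι-mono-≤ {n = n} z≤n = 0≤ι n
  ι-mono-≤ (s≤s m≤n)   = +-mono-≤ ≤.refl (ι-mono-≤ m≤n)

  ι-cancel-≤ : ∀ {m n} → ι m ≤ ι n → m ℕ.≤ n
  ι-cancel-≤ {m} {n} le with m ℕ.≤? n
  ... | yes m≤n = m≤n
  ... | no m≰n  = ⊥-elim (<⇒≱ 0<1 (+-cancelʳ-≤ (ι n)
      (≤.trans (ι-mono-≤ (ℕ.≰⇒> m≰n)) (≤.trans le (≤.reflexive (sym (+-identityˡ _)))))))

  abstract
    -- Otherwise the naturals have a supremum `u`, and `u - 1#` still bounds them because
    -- `ι (suc n) ≤ u`.
    archimedean : ∀ x → ∃[ n ] x ≤ ι n
    archimedean x with dec (∃[ n ] x ≤ ι n)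
    ... | yes p = p
    ... | no ¬p with complete (λ y → ∃[ n ] y ≈ ι n) (0# , 0 , refl)
                      (x , λ { y (n , y≈n) → ≤.≤-respˡ-≈ (sym y≈n) (≰⇒≥ λ x≤n → ¬p (n , x≤n)) })
    ... | u , ub , least = ⊥-elim (<⇒≱ 0<1 (≤-certificate (0≤y-x (least (u - 1#) ub′))
            (solve 1 (λ u → con (+ 0) :- con (+ 1) := (u :- con (+ 1)) :- u) refl u)))
      where
      ub′ : IsUpperBound _≤_ (λ y → ∃[ n ] y ≈ ι n) (u - 1#)
      ub′ y (n , y≈n) = ≤-certificate (0≤y-x (ub (ι (suc n)) (suc n , refl)))
        (trans (+-congˡ (-‿cong y≈n)) (solve 2 (λ u n → (u :- con (+ 1)) :- n := u :- (con (+ 1) :+ n)) refl u (ι n)))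

    floor : ∀ x → 0# ≤ x → ∃[ p ] ι p ≤ x × ¬ (ι (suc p) ≤ x)
    -- Adding `1#` makes `ι N ≤ x` fail, so the search can run downwards from `N`.
    floor x 0≤x with archimedean (x + 1#)
    ... | N , x+1≤N = search N λ N≤x → <⇒≱ 0<1 (≤-certificate (0≤y-x (≤.trans x+1≤N N≤x))
                          (solve 1 (λ x → con (+ 0) :- con (+ 1) := x :- (x :+ con (+ 1))) refl x))
      where
      search : ∀ N → ¬ (ι N ≤ x) → ∃[ p ] ι p ≤ x × ¬ (ι (suc p) ≤ x)
      search zero    N≰x = ⊥-elim (N≰x 0≤x)
      search (suc N) N≰x with ι N ≤? x
      ... | yes le = N , le , N≰x
      ... | no nle = search N nle

  -- Powers of one half

  2# : Carrier
  2# = 1# + 1#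

  0<2 : 0# < 2#
  0<2 = 0<+ 0<1 0≤1

  ½ : Carrier
  ½ = 2# ⁻¹

  ½+½≈1 : ½ + ½ ≈ 1#
  ½+½≈1 = trans (solve 1 (λ h → h :+ h := (con (+ 2)) :* h) refl ½) (⁻¹-inverseʳ 2# (>⇒≉0 0<2))

  0<½ : 0# < ½
  0<½ = 0<x⇒0≤x⁻¹ 0<2 , λ 0≈½ → 0≉1 (trans (sym (trans (+-cong (sym 0≈½) (sym 0≈½)) (+-identityˡ 0#))) ½+½≈1)

  ^-nonNeg : ∀ {x} n → 0# ≤ x → 0# ≤ x ^ n
  ^-nonNeg zero    _   = 0≤1
  ^-nonNeg (suc n) 0≤x = *-nonNeg 0≤x (^-nonNeg n 0≤x)

  ^-pos : ∀ {x} n → 0# < x → 0# < x ^ n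
  ^-pos zero    _   = 0<1
  ^-pos (suc n) 0<x = 0<* 0<x (^-pos n 0<x)

  ^-mono-≤ : ∀ {x y} n → 0# ≤ x → x ≤ y → x ^ n ≤ y ^ n
  ^-mono-≤ zero    _   _   = ≤.refl
  ^-mono-≤ (suc n) 0≤x x≤y = *-mono-≤ 0≤x x≤y (^-nonNeg n 0≤x) (^-mono-≤ n 0≤x x≤y)

  ^-cancel-≤ : ∀ {x y} n → 0# ≤ x → 0# ≤ y → x ^ suc n ≤ y ^ suc n → x ≤ y
  ^-cancel-≤ {x} {y} n 0≤x 0≤y le with x ≤? y
  ... | yes x≤y = x≤y
  ... | no x≰y = *-cancelʳ-≤ (x ^ n) (^-pos n (<-≤-trans′ 0≤y (≰⇒> x≰y)))
                   (≤.trans le (*-monoˡ-≤ y 0≤y (^-mono-≤ n 0≤y (≰⇒≥ x≰y))))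
    where
    <-≤-trans′ : ∀ {a b c} → a ≤ b → b < c → a < c
    <-≤-trans′ a≤b (b≤c , b≉c) = ≤.trans a≤b b≤c , λ a≈c → b≉c (≤.antisym b≤c (≤.≤-respˡ-≈ a≈c a≤b))

  h : ℕ → Carrier
  h n = ½ ^ n

  0<h : ∀ n → 0# < h n
  0<h n = ^-pos n 0<½

  0≤h : ∀ n → 0# ≤ h n
  0≤h n = proj₁ (0<h n)

  h-split : ∀ n → h (suc n) + h (suc n) ≈ h n
  h-split n = trans (sym (distribʳ (h n) ½ ½)) (trans (*-congʳ ½+½≈1) (*-identityˡ (h n)))

  h-+ : ∀ m n → h (m ℕ.+ n) ≈ h m * h n
  h-+ = ^-homo-* ½

  h-suc-≤ : ∀ n → h (suc n) ≤ h n
  h-suc-≤ n = ≤.≤-respʳ-≈ (h-split n) (x≤x+y (0≤h (suc n)))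

  h≤1 : ∀ n → h n ≤ 1#
  h≤1 zero    = ≤.refl
  h≤1 (suc n) = ≤.trans (h-suc-≤ n) (h≤1 n)

  h-anti-≤ : ∀ {m n} → m ℕ.≤ n → h n ≤ h m
  h-anti-≤ {n = n} z≤n = h≤1 n
  h-anti-≤ (s≤s m≤n)   = *-monoˡ-≤ ½ (proj₁ 0<½) (h-anti-≤ m≤n)

  h-^ : ∀ k p → h k ^ p ≈ h (k ℕ.* p)
  h-^ = ^-assocʳ ½

  ι2^n*h≈1 : ∀ n → ι (2 ℕ.^ n) * h n ≈ 1#
  ι2^n*h≈1 zero    = trans (*-identityʳ _) (+-identityʳ 1#)
  ι2^n*h≈1 (suc n) = begin
    ι (2 ℕ.* 2 ℕ.^ n) * h (suc n)                  ≈⟨ *-congʳ (×1-homo-* 2 (2 ℕ.^ n)) ⟩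
    (ι 2 * ι (2 ℕ.^ n)) * h (suc n)                ≈⟨ solve 2 (λ x y → ((con (+ 1) :+ (con (+ 1) :+ con (+ 0))) :* x) :* y := x :* (y :+ y)) refl (ι (2 ℕ.^ n)) (h (suc n)) ⟩
    ι (2 ℕ.^ n) * (h (suc n) + h (suc n))          ≈⟨ *-congˡ (h-split n) ⟩
    ι (2 ℕ.^ n) * h n                              ≈⟨ ι2^n*h≈1 n ⟩
    1#                                             ∎

  n≤2^n : ∀ n → n ℕ.≤ 2 ℕ.^ n
  n≤2^n zero    = z≤n
  n≤2^n (suc n) = ℕ.≤-trans (ℕ.+-mono-≤ (ℕ.m^n>0 2 n) (n≤2^n n)) (ℕ.≤-reflexive (≡.cong (2 ℕ.^ n ℕ.+_) (≡.sym (ℕ.+-identityʳ _))))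

  ιn*h≤1 : ∀ n → ι n * h n ≤ 1#
  ιn*h≤1 n = ≤.≤-respʳ-≈ (ι2^n*h≈1 n) (*-monoʳ-≤ (h n) (0≤h n) (ι-mono-≤ (n≤2^n n)))

  abstract
    -- Since n 2⁻ⁿ ≤ 1, any n ≥ `ε ⁻¹` gives 2⁻ⁿ ≤ ε n 2⁻ⁿ ≤ ε.
    h-small : ∀ {ε} → 0# < ε → ∃[ n ] h n ≤ ε
    h-small {ε} 0<ε with archimedean (ε ⁻¹)
    ... | n , le = n , ≤.≤-respˡ-≈ (eq₁) (≤.≤-respʳ-≈ (*-identityʳ ε)
        (*-monoˡ-≤ ε (proj₁ 0<ε) (≤.trans (*-monoʳ-≤ (h n) (0≤h n) le) (ιn*h≤1 n))))
      where
      eq₁ : ε * (ε ⁻¹ * h n) ≈ h n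
      eq₁ = trans (sym (*-assoc _ _ _)) (trans (*-congʳ (⁻¹-inverseʳ ε (>⇒≉0 0<ε))) (*-identityˡ _))

  halving-step : ∀ {x y a b} → a + a ≈ b → x ≤ y + a → b ≤ x - y → a ≤ 0#
  halving-step {x} {y} {a} {b} a+a≈b x≤y+a b≤x-y = ≤-certificate
    (+-nonNeg ℝ (0≤y-x x≤y+a) (0≤y-x (≤.≤-respˡ-≈ (sym a+a≈b) b≤x-y)))
    (solve 3 (λ x y a → con (+ 0) :- a := ((y :+ a) :- x) :+ ((x :- y) :- (a :+ a))) refl x y a)

  0<y-x : ∀ {x y} → ¬ (y ≤ x) → 0# < y - x
  0<y-x {x} {y} y≰x = 0≤y-x (≰⇒≥ y≰x) , λ 0≈y-x → y≰x (≤-certificate (≤.reflexive (sym -0#≈0#))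
    (trans (solve 2 (λ x y → x :- y := :- (y :- x)) refl x y) (-‿cong (sym 0≈y-x))))

  -- If `h n` fitted into a positive gap `x - y`, the hypothesis at `suc n` would bound the gap by
  -- half of `h n`.
  ≤-from-h : ∀ {x y} → (∀ n → x ≤ y + h n) → x ≤ y
  ≤-from-h {x} {y} le with x ≤? y
  ... | yes x≤y = x≤y
  ... | no x≰y =
    let n , hn≤ = h-small (0<y-x x≰y)
    in ⊥-elim (<⇒≱ (0<h (suc n)) (halving-step (h-split n) (le (suc n)) hn≤))

  -- Rational spans and Hamel bases

  open import Algebra.Properties.CommutativeMonoid.Sum +-commutativeMonoid using (sum-remove)

  *-cancelʳ-≈ : ∀ {a b c} → ¬ (c ≈ 0#) → a * c ≈ b * c → a ≈ b
  *-cancelʳ-≈ {a} {b} {c} c≉0 ac≈bc = trans (sym (undo a)) (trans (*-congʳ ac≈bc) (undo b))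
    where
    undo : ∀ x → (x * c) * c ⁻¹ ≈ x
    undo x = trans (*-assoc _ _ _) (trans (*-congˡ (⁻¹-inverseʳ c c≉0)) (*-identityʳ x))

  ι≉0 : ∀ n .{{_ : ℕ.NonZero n}} → ¬ (ι n ≈ 0#)
  ι≉0 (suc n) = >⇒≉0 (0<ι n)

  fromℚ-↥ : ∀ q → fromℚ ℝ q * ι (↧ₙ q) ≈ fromℤ ℝ (↥ q)
  fromℚ-↥ q@record{} = trans (*-assoc _ _ _)
    (trans (*-congˡ (trans (*-comm _ _) (⁻¹-inverseʳ _ (ι≉0 (↧ₙ q))))) (*-identityʳ _))

  -- The quotient is stored in lowest terms; multiplying by the gcd restores `i` and `n`.
  fromℚ-/ : ∀ i n .{{_ : ℕ.NonZero n}} → fromℚ ℝ (i ℚ./ n) * ι n ≈ fromℤ ℝ i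
  fromℚ-/ i n = begin
    x * ι n                              ≈⟨ *-congˡ (reflexive (≡.cong (fromℤ ℝ) (ℚ.↧-/ i n))) ⟨
    x * fromℤ ℝ (↧ (i ℚ./ n) ℤ.* g)      ≈⟨ *-congˡ (fromℤ-* (↧ (i ℚ./ n)) g) ⟩
    x * (ι (↧ₙ (i ℚ./ n)) * fromℤ ℝ g)   ≈⟨ *-assoc _ _ _ ⟨
    (x * ι (↧ₙ (i ℚ./ n))) * fromℤ ℝ g   ≈⟨ *-congʳ (fromℚ-↥ (i ℚ./ n)) ⟩
    fromℤ ℝ (↥ (i ℚ./ n)) * fromℤ ℝ g    ≈⟨ fromℤ-* (↥ (i ℚ./ n)) g ⟨
    fromℤ ℝ (↥ (i ℚ./ n) ℤ.* g)          ≈⟨ reflexive (≡.cong (fromℤ ℝ) (ℚ.↥-/ i n)) ⟩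
    fromℤ ℝ i                            ∎
    where
    x = fromℚ ℝ (i ℚ./ n)
    g = ℤ.gcd i (+ n)

  fromℚ-* : ∀ p q → fromℚ ℝ (p ℚ.* q) ≈ fromℚ ℝ p * fromℚ ℝ q
  fromℚ-* p@record{} q@record{} = *-cancelʳ-≈ (ι≉0 (↧ₙ p ℕ.* ↧ₙ q)) (begin
    fromℚ ℝ (p ℚ.* q) * ι (↧ₙ p ℕ.* ↧ₙ q)                    ≈⟨ fromℚ-/ (↥ p ℤ.* ↥ q) (↧ₙ p ℕ.* ↧ₙ q) ⟩
    fromℤ ℝ (↥ p ℤ.* ↥ q)                                    ≈⟨ fromℤ-* (↥ p) (↥ q) ⟩
    fromℤ ℝ (↥ p) * fromℤ ℝ (↥ q)                            ≈⟨ *-cong (fromℚ-↥ p) (fromℚ-↥ q) ⟨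
    (fromℚ ℝ p * ι (↧ₙ p)) * (fromℚ ℝ q * ι (↧ₙ q))          ≈⟨ solve 4 (λ a b c d → (a :* b) :* (c :* d) := (a :* c) :* (b :* d)) refl (fromℚ ℝ p) (ι (↧ₙ p)) (fromℚ ℝ q) (ι (↧ₙ q)) ⟩
    (fromℚ ℝ p * fromℚ ℝ q) * (ι (↧ₙ p) * ι (↧ₙ q))          ≈⟨ *-congˡ (×1-homo-* (↧ₙ p) (↧ₙ q)) ⟨
    (fromℚ ℝ p * fromℚ ℝ q) * ι (↧ₙ p ℕ.* ↧ₙ q)              ∎)

  fromℚ-ℤ : ∀ i → fromℚ ℝ (i ℚ./ 1) ≈ fromℤ ℝ i
  fromℚ-ℤ i = trans (sym (trans (*-congˡ (+-identityʳ 1#)) (*-identityʳ _))) (fromℚ-/ i 1)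

  fromℚ-inverse : ∀ q .{{_ : ℚ.NonZero q}} → fromℚ ℝ (ℚ.1/ q) * fromℚ ℝ q ≈ 1#
  fromℚ-inverse q = trans (sym (fromℚ-* (ℚ.1/ q) q))
    (trans (reflexive (≡.cong (fromℚ ℝ) (ℚ.*-inverseˡ q))) (trans (fromℚ-ℤ (+ 1)) (+-identityʳ 1#)))

  -1ℚ : ℚ
  -1ℚ = -[1+ 0 ] ℚ./ 1

  fromℚ-neg : ∀ x → fromℚ ℝ -1ℚ * x ≈ - x
  fromℚ-neg x = trans (*-congʳ (fromℚ-ℤ -[1+ 0 ])) (solve 1 (λ x → (:- (con (+ 1) :+ con (+ 0))) :* x := :- x) refl x)

  -- Unlike in `LinearlyIndependent`, vectors may repeat, so sums are concatenations and no terms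
  -- have to be merged.
  data Span (S : Pred Carrier 0ℓ) : Pred Carrier 0ℓ where
    span-0 : ∀ {x} → x ≈ 0# → Span S x
    span-∷ : ∀ {x v y} q → S v → Span S y → x ≈ fromℚ ℝ q * v + y → Span S x

  module _ {S : Pred Carrier 0ℓ} where

    Span-resp : Span S Respects _≈_
    Span-resp x≈y (span-0 x≈0)          = span-0 (trans (sym x≈y) x≈0)
    Span-resp x≈y (span-∷ q v∈S z eq) = span-∷ q v∈S z (trans (sym x≈y) eq)

    Span-+ : ∀ {x y} → Span S x → Span S y → Span S (x + y)
    Span-+ (span-0 x≈0)        y∈ = Span-resp (sym (trans (+-congʳ x≈0) (+-identityˡ _))) y∈
    Span-+ (span-∷ q v∈S z eq) y∈ = span-∷ q v∈S (Span-+ z y∈) (trans (+-congʳ eq) (+-assoc _ _ _))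

    Span-* : ∀ {x} q → Span S x → Span S (fromℚ ℝ q * x)
    Span-* q (span-0 x≈0) = span-0 (trans (*-congˡ x≈0) (zeroʳ _))
    Span-* q (span-∷ p v∈S z eq) = span-∷ (q ℚ.* p) v∈S (Span-* q z)
      (trans (*-congˡ eq) (trans (distribˡ _ _ _) (+-congʳ (trans (sym (*-assoc _ _ _)) (*-congʳ (sym (fromℚ-* q p)))))))

    Span-neg : ∀ {x} → Span S x → Span S (- x)
    Span-neg x∈ = Span-resp (fromℚ-neg _) (Span-* -1ℚ x∈)

    Span-ι : ∀ {x} n → Span S x → Span S (ι n * x)
    Span-ι n x∈ = Span-resp (*-congʳ (fromℚ-ℤ (+ n))) (Span-* ((+ n) ℚ./ 1) x∈)

    Span-generator : S ⊆ Span S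
    Span-generator v∈S = span-∷ 1ℚ v∈S (span-0 refl)
      (sym (trans (+-identityʳ _) (trans (*-congʳ (trans (fromℚ-ℤ (+ 1)) (+-identityʳ 1#))) (*-identityˡ _))))

    linearCombination∈Span : ∀ {n} (q : Fin n → ℚ) (v : Fin n → Carrier) → (∀ i → v i ∈ S) → Span S (linearCombination ℝ q v)
    linearCombination∈Span {zero}  q v v∈S = span-0 refl
    linearCombination∈Span {suc n} q v v∈S =
      span-∷ (q zero) (v∈S zero) (linearCombination∈Span (q ∘ suc) (v ∘ suc) (v∈S ∘ suc)) refl

    Span⇒linearCombination : ∀ {x} → Span S x →
      ∃[ n ] Σ[ v ∈ (Fin n → Carrier) ] Σ[ q ∈ (Fin n → ℚ) ] (∀ i → v i ∈ S) × x ≈ linearCombination ℝ q v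
    Span⇒linearCombination (span-0 x≈0) = 0 , (λ ()) , (λ ()) , (λ ()) , x≈0
    Span⇒linearCombination (span-∷ {v = w} p w∈S z eq) =
      let n , v , q , v∈S , z≈ = Span⇒linearCombination z
      in suc n , w Vector.∷ v , p Vector.∷ q , (λ { zero → w∈S ; (suc i) → v∈S i }) , trans eq (+-congˡ z≈)

  Span-bind : ∀ {S T : Pred Carrier 0ℓ} → S ⊆ Span T → Span S ⊆ Span T
  Span-bind f (span-0 x≈0)          = span-0 x≈0
  Span-bind f (span-∷ q v∈S z eq) = Span-resp (sym eq) (Span-+ (Span-* q (f v∈S)) (Span-bind f z))

  Span-mono : ∀ {S T : Pred Carrier 0ℓ} → S ⊆ T → Span S ⊆ Span T
  Span-mono f = Span-bind (λ s → Span-generator (f s))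

  module Greedy (I : StrictTotalOrder 0ℓ 0ℓ 0ℓ) (wf : WellFounded (StrictTotalOrder._<_ I))
                (v : StrictTotalOrder.Carrier I → Carrier)
                (v-cong : ∀ {i j} → StrictTotalOrder._≈_ I i j → v i ≈ v j) where
    private module I = StrictTotalOrder I

    Before : I.Carrier → Pred Carrier 0ℓ
    Before i x = ∃[ j ] j I.< i × x ≈ v j

    Basis : Pred Carrier 0ℓ
    Basis x = ∃[ i ] x ≈ v i × ¬ Span (Before i) (v i)

    Basis-resp : Basis Respects _≈_
    Basis-resp x≈y (i , x≈ , new) = i , trans (sym x≈y) x≈ , new

    maximal : ∀ n (f : Fin (suc n) → I.Carrier) → ∃[ m ] ∀ k → ¬ (f m I.< f k)
    maximal zero f = zero , λ { zero → I.irrefl I.Eq.refl }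
    maximal (suc n) f with maximal n (f ∘ suc)
    ... | m , max with I.compare (f zero) (f (suc m))
    ... | tri< a _ c = suc m , λ { zero → c ; (suc k) → max k }
    ... | tri≈ _ e c = suc m , λ { zero → c ; (suc k) → max k }
    ... | tri> _ _ c = zero , λ { zero → I.irrefl I.Eq.refl ; (suc k) lt → max k (I.trans c lt) }

    -- In a relation, the vector of latest index would lie in the span of its predecessors if its
    -- coefficient were nonzero. So that coefficient vanishes, and induction applies to the
    -- remaining vectors.
    Basis-independent : LinearlyIndependent ℝ Basis
    Basis-independent zero u inj u∈B q comb≈0 ()
    Basis-independent (suc n) u inj u∈B q comb≈0 = result
      where
      index : Fin (suc n) → I.Carrier
      index k = proj₁ (u∈B k)

      m : Fin (suc n)
      m = proj₁ (maximal n index)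

      earlier : ∀ k → u (punchIn m k) ∈ Before (index m)
      earlier k with I.compare (index (punchIn m k)) (index m)
      ... | tri< lt _ _ = index (punchIn m k) , lt , proj₁ (proj₂ (u∈B (punchIn m k)))
      -- Equal indices would give equal vectors, against the injectivity of `u`.
      ... | tri≈ _ eq _ = ⊥-elim (Fin.punchInᵢ≢i m k (inj (trans (proj₁ (proj₂ (u∈B (punchIn m k))))
                            (trans (v-cong eq) (sym (proj₁ (proj₂ (u∈B m))))))))
      ... | tri> _ _ gt = ⊥-elim (proj₂ (maximal n index) (punchIn m k) gt)

      rest : Carrier
      rest = linearCombination ℝ (q ∘ punchIn m) (u ∘ punchIn m)

      split : fromℚ ℝ (q m) * u m + rest ≈ 0#
      split = trans (sym (sum-remove (λ i → fromℚ ℝ (q i) * u i))) comb≈0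

      qm≡0 : q m ≡ 0ℚ
      qm≡0 with q m ℚ.≟ 0ℚ
      ... | yes eq = eq
      ... | no qm≢0 = ⊥-elim (proj₂ (proj₂ (u∈B m)) (Span-resp (trans (sym um≈) (proj₁ (proj₂ (u∈B m))))
              (Span-* (ℚ.1/ (q m)) (Span-neg (linearCombination∈Span (q ∘ punchIn m) (u ∘ punchIn m) earlier)))))
        where
        instance _ = ℚ.≢-nonZero qm≢0
        um≈ : u m ≈ fromℚ ℝ (ℚ.1/ (q m)) * - rest
        um≈ = begin
          u m                                              ≈⟨ *-identityˡ (u m) ⟨
          1# * u m                                         ≈⟨ *-congʳ (fromℚ-inverse (q m)) ⟨
          (r * fromℚ ℝ (q m)) * u m                        ≈⟨ solve 4 (λ r a b c → (r :* a) :* b := r :* ((a :* b :+ c) :- c)) refl r (fromℚ ℝ (q m)) (u m) rest ⟩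
          r * ((fromℚ ℝ (q m) * u m + rest) - rest)        ≈⟨ *-congˡ (+-congʳ split) ⟩
          r * (0# - rest)                                  ≈⟨ *-congˡ (+-identityˡ _) ⟩
          r * - rest                                       ∎
          where r = fromℚ ℝ (ℚ.1/ (q m))

      rest≈0 : rest ≈ 0#
      rest≈0 = trans (sym (trans (+-congʳ (trans (*-congʳ (trans (reflexive (≡.cong (fromℚ ℝ) qm≡0)) (fromℚ-ℤ (+ 0)))) (zeroˡ _))) (+-identityˡ rest))) split

      result : ∀ i → q i ≡ 0ℚ
      result i with m Fin.≟ i
      ... | yes ≡.refl = qm≡0
      ... | no m≢i = ≡.subst (λ k → q k ≡ 0ℚ) (Fin.punchIn-punchOut m≢i)
              (Basis-independent n (u ∘ punchIn m) (λ eq → Fin.punchIn-injective m _ _ (inj eq))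
                (u∈B ∘ punchIn m) (q ∘ punchIn m) rest≈0 (punchOut m≢i))

    -- A rejected vector is spanned by its predecessors, which are spanned by the basis by
    -- well-founded induction.
    v∈Span-Basis : ∀ i → Acc I._<_ i → Span Basis (v i)
    v∈Span-Basis i (acc rs) with dec (Span (Before i) (v i))
    ... | no new = Span-generator (i , refl , new)
    ... | yes old = Span-bind (λ { (j , j<i , x≈) → Span-resp (sym x≈) (v∈Span-Basis j (rs j<i)) }) old

    Basis-hamel : (∀ x → Span (λ y → ∃[ i ] y ≈ v i) x) → IsHamelBasis ℝ Basis
    Basis-hamel spans = record
      { respects-≈  = Basis-resp
      ; independent = Basis-independent
      ; spanning    = λ x → Span⇒linearCombination
          (Span-bind (λ { (i , y≈) → Span-resp (sym y≈) (v∈Span-Basis i (wf i)) }) (spans x))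
      }

  -- Binary expansions of real numbers

  truncation : Digits → ℕ → Carrier
  truncation d n = ι (leading d n) * h n

  truncation-suc : ∀ d n → truncation d (suc n) ≈ truncation d n + ι (bit (d n)) * h (suc n)
  truncation-suc d n = begin
    ι ((l ℕ.+ l) ℕ.+ b) * h (suc n)               ≈⟨ *-congʳ (trans (×-homo-+ 1# (l ℕ.+ l) b) (+-congʳ (×-homo-+ 1# l l))) ⟩
    ((ι l + ι l) + ι b) * h (suc n)               ≈⟨ solve 3 (λ l b h → ((l :+ l) :+ b) :* h := l :* (h :+ h) :+ b :* h) refl (ι l) (ι b) (h (suc n)) ⟩
    ι l * (h (suc n) + h (suc n)) + ι b * h (suc n) ≈⟨ +-congʳ (*-congˡ (h-split n)) ⟩
    ι l * h n + ι b * h (suc n)                   ∎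
    where
    l = leading d n
    b = bit (d n)

  bit≤1 : ∀ b → ι (bit b) ≤ 1#
  bit≤1 false = 0≤1
  bit≤1 true  = ≤.reflexive (+-identityʳ 1#)

  truncation-≤-suc : ∀ d n → truncation d n ≤ truncation d (suc n)
  truncation-≤-suc d n = ≤.≤-respʳ-≈ (sym (truncation-suc d n)) (x≤x+y (*-nonNeg (0≤ι (bit (d n))) (0≤h (suc n))))

  -- With `truncation-≤-suc` this makes the dyadic intervals from `truncation d n` to
  -- `truncation d n + h n` nested.
  truncation-suc-≤ : ∀ d n → truncation d (suc n) + h (suc n) ≤ truncation d n + h n
  truncation-suc-≤ d n = ≤.≤-respˡ-≈ (+-congʳ (sym (truncation-suc d n)))
    (≤.≤-respʳ-≈ (trans (+-assoc _ _ _) (+-congˡ (h-split n)))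
      (+-mono-≤ (+-mono-≤ ≤.refl (≤.≤-respʳ-≈ (*-identityˡ _) (*-monoʳ-≤ (h (suc n)) (0≤h (suc n)) (bit≤1 (d n))))) ≤.refl))

  truncation-mono : ∀ d {m n} → m ℕ.≤′ n → truncation d m ≤ truncation d n
  truncation-mono d (ℕ.≤′-reflexive ≡.refl) = ≤.refl
  truncation-mono d (ℕ.≤′-step {n} m≤n)     = ≤.trans (truncation-mono d m≤n) (truncation-≤-suc d n)

  truncation-bound-anti : ∀ d {m n} → m ℕ.≤′ n → truncation d n + h n ≤ truncation d m + h m
  truncation-bound-anti d (ℕ.≤′-reflexive ≡.refl) = ≤.refl
  truncation-bound-anti d (ℕ.≤′-step {n} m≤n)     = ≤.trans (truncation-suc-≤ d n) (truncation-bound-anti d m≤n)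

  truncation-≤ : ∀ d m n → truncation d m ≤ truncation d n + h n
  truncation-≤ d m n with ℕ.≤-total m n
  ... | inj₁ m≤n = ≤.trans (truncation-mono d (ℕ.≤⇒≤′ m≤n)) (x≤x+y (0≤h n))
  ... | inj₂ n≤m = ≤.trans (x≤x+y (0≤h m)) (truncation-bound-anti d (ℕ.≤⇒≤′ n≤m))

  abstract
    val-supremum : ∀ d → ∃ (IsSupremum _≤_ (λ y → ∃[ n ] y ≈ truncation d n))
    val-supremum d = complete _ (truncation d 0 , 0 , refl)
      (truncation d 0 + h 0 , λ { y (n , y≈) → ≤.≤-respˡ-≈ (sym y≈) (truncation-≤ d n 0) })

    val : Digits → Carrier
    val d = proj₁ (val-supremum d)

    truncation≤val : ∀ d n → truncation d n ≤ val d
    truncation≤val d n = proj₁ (proj₂ (val-supremum d)) _ (n , refl)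

    val≤truncation : ∀ d n → val d ≤ truncation d n + h n
    val≤truncation d n = proj₂ (proj₂ (val-supremum d)) _
      λ { y (m , y≈) → ≤.≤-respˡ-≈ (sym y≈) (truncation-≤ d m n) }

  -- Both `x` and `val d` lie in all the nested intervals, whose lengths tend to 0.
  ≈val : ∀ {x} d → (∀ n → truncation d n ≤ x) → (∀ n → x ≤ truncation d n + h n) → x ≈ val d
  ≈val d lower upper = ≤.antisym
    (≤-from-h λ n → ≤.trans (upper n) (+-mono-≤ (truncation≤val d n) ≤.refl))
    (≤-from-h λ n → ≤.trans (val≤truncation d n) (+-mono-≤ (lower n) ≤.refl))

  val-+ : ∀ {d d₁ d₂} → (∀ i → bit (d i) ≡ bit (d₁ i) ℕ.+ bit (d₂ i)) → val d ≈ val d₁ + val d₂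
  val-+ {d} {d₁} {d₂} eq = ≤.antisym (≤-from-h upper) (≤-from-h lower)
    where
    split : ∀ n → truncation d n ≈ truncation d₁ n + truncation d₂ n
    split n = trans (*-congʳ (trans (×-congˡ (leading-+ {d} {d₁} {d₂} eq n)) (×-homo-+ 1# (leading d₁ n) (leading d₂ n)))) (distribʳ _ _ _)

    upper : ∀ n → val d ≤ (val d₁ + val d₂) + h n
    upper n = ≤.trans (val≤truncation d n)
      (+-mono-≤ (≤.≤-respˡ-≈ (sym (split n)) (+-mono-≤ (truncation≤val d₁ n) (truncation≤val d₂ n))) ≤.refl)

    lower : ∀ n → val d₁ + val d₂ ≤ val d + h n
    -- Depth `suc n` is used because the errors of the two summands add up to `h n`.
    lower n = ≤.trans (+-mono-≤ (val≤truncation d₁ (suc n)) (val≤truncation d₂ (suc n)))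
      (≤.≤-respˡ-≈ (trans (+-cong (split (suc n)) (sym (h-split n)))
          (solve 3 (λ a b c → (a :+ b) :+ (c :+ c) := (a :+ c) :+ (b :+ c)) refl (truncation d₁ (suc n)) (truncation d₂ (suc n)) (h (suc n))))
        (+-mono-≤ (truncation≤val d (suc n)) ≤.refl))

  val-shift : ∀ d → val (shift d) + val (shift d) ≈ val d
  val-shift d = ≈val d lower upper
    where
    double : ∀ n → truncation (shift d) (suc n) + truncation (shift d) (suc n) ≈ truncation d n
    double n = trans (sym (distribˡ _ _ _)) (*-cong (×-congˡ (leading-shift d n)) (h-split n))

    lower : ∀ n → truncation d n ≤ val (shift d) + val (shift d)
    lower n = ≤.≤-respˡ-≈ (double n) (+-mono-≤ (truncation≤val (shift d) (suc n)) (truncation≤val (shift d) (suc n)))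

    upper : ∀ n → val (shift d) + val (shift d) ≤ truncation d n + h n
    upper n = ≤.≤-respʳ-≈
      (trans (solve 2 (λ a b → (a :+ b) :+ (a :+ b) := (a :+ a) :+ (b :+ b)) refl (truncation (shift d) (suc n)) (h (suc n))) (+-cong (double n) (h-split n)))
      (+-mono-≤ (val≤truncation (shift d) (suc n)) (val≤truncation (shift d) (suc n)))

  module _ (x : Carrier) where
    -- Compares `x` with the midpoint of the current dyadic interval. Ties take the digit 1 and the
    -- intervals are closed, so `x ≈ 1#` has the expansion consisting of ones only.
    nextBit : ℕ → ℕ → Bool
    nextBit n l = does (ι ((l ℕ.+ l) ℕ.+ 1) * h (suc n) ≤? x)

    expansionLeading : ℕ → ℕ
    expansionLeading zero    = 0
    expansionLeading (suc n) = (expansionLeading n ℕ.+ expansionLeading n) ℕ.+ bit (nextBit n (expansionLeading n))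

    expansion : Digits
    expansion n = nextBit n (expansionLeading n)

    leading-expansion : ∀ n → leading expansion n ≡ expansionLeading n
    leading-expansion zero    = ≡.refl
    leading-expansion (suc n) = ≡.cong (λ l → (l ℕ.+ l) ℕ.+ bit (expansion n)) (leading-expansion n)

    module _ (0≤x : 0# ≤ x) (x≤1 : x ≤ 1#) where

      Invariant : ℕ → ℕ → Set
      Invariant n l = ι l * h n ≤ x × x ≤ ι l * h n + h n

      double-≈ : ∀ n l → ι (l ℕ.+ l) * h (suc n) ≈ ι l * h n
      double-≈ n l = trans (*-congʳ (×-homo-+ 1# l l)) (trans (distribʳ _ _ _) (trans (sym (distribˡ _ _ _)) (*-congˡ (h-split n))))

      +1-≈ : ∀ n m → ι (m ℕ.+ 1) * h n ≈ ι m * h n + h n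
      +1-≈ n m = trans (*-congʳ (×-homo-+ 1# m 1)) (solve 2 (λ m h → (m :+ (con (+ 1) :+ con (+ 0))) :* h := m :* h :+ h) refl (ι m) (h n))

      step : ∀ n l → Invariant n l → Invariant (suc n) ((l ℕ.+ l) ℕ.+ bit (nextBit n l))
      step n l (lo , hi) with ι ((l ℕ.+ l) ℕ.+ 1) * h (suc n) ≤? x
      ... | yes le = le , ≤.trans hi (≤.reflexive (sym (trans (+-congʳ (+1-≈ (suc n) (l ℕ.+ l)))
                       (trans (+-assoc _ _ _) (+-cong (double-≈ n l) (h-split n))))))
      ... | no nle rewrite ℕ.+-identityʳ (l ℕ.+ l) =
        ≤.≤-respˡ-≈ (sym (double-≈ n l)) lo , ≤.≤-respʳ-≈ (+1-≈ (suc n) (l ℕ.+ l)) (≰⇒≥ nle)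

      invariant : ∀ n → Invariant n (expansionLeading n)
      invariant zero    = ≤.≤-respˡ-≈ (sym (zeroˡ _)) 0≤x , ≤.≤-respʳ-≈ (sym (trans (+-congʳ (zeroˡ _)) (+-identityˡ _))) x≤1
      invariant (suc n) = step n (expansionLeading n) (invariant n)

      ≈val-expansion : x ≈ val expansion
      ≈val-expansion = ≈val expansion
        (λ n → ≡.subst (λ l → ι l * h n ≤ x) (≡.sym (leading-expansion n)) (proj₁ (invariant n)))
        (λ n → ≡.subst (λ l → x ≤ ι l * h n + h n) (≡.sym (leading-expansion n)) (proj₂ (invariant n)))

  -- Reals with digits in `A`, and their rational span

  module _ (A : Digits) where

    CantorSet : Pred Carrier 0ℓ
    CantorSet x = ∃[ d ] SupportedOn A d × x ≈ val d

    ∧-true : ∀ {x y} → x ∧ y ≡ true → x ≡ true × y ≡ true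
    ∧-true {true} {true} _ = ≡.refl , ≡.refl

    not-true : ∀ {x} → not x ≡ true → ¬ (x ≡ true)
    not-true {true} () _

    -- Halving a number moves its digits one place to the right, towards the next element of A.
    val∈Span : ∀ k d → (∀ n → d n ≡ true → ∃[ j ] j ℕ.< k × A (n ℕ.+ j) ≡ true) → Span CantorSet (val d)
    val∈Span zero d near = Span-generator (d , (λ n dn → case (near n dn)) , refl)
      where
      case : ∀ {n} → (∃[ j ] j ℕ.< 0 × A (n ℕ.+ j) ≡ true) → A n ≡ true
      case (j , () , _)
    val∈Span (suc k) d near = Span-resp (sym (val-+ {d} {d ⊓ᵈ A} {d ∖ᵈ A} λ i → bit-split (d i) (A i)))
      (Span-+ (Span-generator (d ⊓ᵈ A , (λ n eq → proj₂ (∧-true {d n} eq)) , refl))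
              (Span-resp (val-shift (d ∖ᵈ A)) (Span-+ rec rec)))
      where
      near′ : ∀ n → shift (d ∖ᵈ A) n ≡ true → ∃[ j ] j ℕ.< k × A (n ℕ.+ j) ≡ true
      near′ (suc n) eq with near n (proj₁ (∧-true {d n} eq))
      ... | zero  , _ , An = ⊥-elim (not-true (proj₂ (∧-true {d n} eq)) (≡.subst (λ m → A m ≡ true) (ℕ.+-identityʳ n) An))
      ... | suc j , s≤s j<k , An = j , j<k , ≡.subst (λ m → A m ≡ true) (ℕ.+-suc n j) An

      rec : Span CantorSet (val (shift (d ∖ᵈ A)))
      rec = val∈Span k (shift (d ∖ᵈ A)) near′

    module _ (k : ℕ) (gap : ∀ n → ∃[ j ] j ℕ.< k × A (n ℕ.+ j) ≡ true) where

      unit∈Span : ∀ x → 0# ≤ x → x ≤ 1# → Span CantorSet x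
      unit∈Span x 0≤x x≤1 = Span-resp (sym (≈val-expansion x 0≤x x≤1)) (val∈Span k (expansion x) (λ n _ → gap n))

      -- Division by a positive natural number above `x` brings `x` into the unit interval, and
      -- natural numbers are rational scalars.
      nonNeg∈Span : ∀ x → 0# ≤ x → Span CantorSet x
      nonNeg∈Span x 0≤x = Span-resp N*y≈x (Span-ι (suc (proj₁ bound)) (unit∈Span y 0≤y y≤1))
        where
        bound = archimedean x
        N = ι (suc (proj₁ bound))
        0<N = 0<ι (proj₁ bound)
        y = x * N ⁻¹
        N*y≈x : N * y ≈ x
        N*y≈x = trans (solve 3 (λ n x i → n :* (x :* i) := x :* (n :* i)) refl N x (N ⁻¹)) (trans (*-congˡ (⁻¹-inverseʳ N (>⇒≉0 0<N))) (*-identityʳ x))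
        0≤y : 0# ≤ y
        0≤y = *-nonNeg 0≤x (0<x⇒0≤x⁻¹ 0<N)
        y≤1 : y ≤ 1#
        y≤1 = *-cancelˡ-≤ N 0<N (≤.≤-respˡ-≈ (sym N*y≈x) (≤.≤-respʳ-≈ (sym (*-identityʳ N))
                (≤.trans (proj₂ bound) (ι-mono-≤ (ℕ.n≤1+n (proj₁ bound))))))

      CantorSet-spans : ∀ x → Span CantorSet x
      CantorSet-spans x with ≤.total 0# x
      ... | inj₁ 0≤x = nonNeg∈Span x 0≤x
      ... | inj₂ x≤0 = Span-resp (-‿involutive x) (Span-neg (nonNeg∈Span (- x) (≤.≤-respˡ-≈ -0#≈0# (neg-mono-≤ x≤0))))

  -- Extended reals, diameters and powers

  ≤∞-trans : ∀ {e f g} → _≤∞_ ℝ e f → _≤∞_ ℝ f g → _≤∞_ ℝ e g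
  ≤∞-trans (fin≤fin x≤y) (fin≤fin y≤z) = fin≤fin (≤.trans x≤y y≤z)
  ≤∞-trans _             ≤∞-top        = ≤∞-top

  ≤∞-total : ∀ e f → _≤∞_ ℝ e f ⊎ _≤∞_ ℝ f e
  ≤∞-total (fin x _) (fin y _) with ≤.total x y
  ... | inj₁ x≤y = inj₁ (fin≤fin x≤y)
  ... | inj₂ y≤x = inj₂ (fin≤fin y≤x)
  ≤∞-total e ∞ = inj₁ ≤∞-top
  ≤∞-total ∞ f = inj₂ ≤∞-top

  0≤∞ : ∀ e → _≤∞_ ℝ (0∞ ℝ) e
  0≤∞ (fin x 0≤x) = fin≤fin 0≤x
  0≤∞ ∞           = ≤∞-top

  fin≤fin⁻¹ : ∀ {x y p q} → _≤∞_ ℝ (fin x p) (fin y q) → x ≤ y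
  fin≤fin⁻¹ (fin≤fin x≤y) = x≤y

  ≤∞-fin⇒≤ : ∀ {e} {p : ∀ n → 0# ≤ h n} → (∀ n → _≤∞_ ℝ e (fin (h n) (p n))) → _≤∞_ ℝ e (0∞ ℝ)
  ≤∞-fin⇒≤ {fin x _} le = fin≤fin (≤-from-h λ n → ≤.≤-respʳ-≈ (sym (+-identityˡ _)) (fin≤fin⁻¹ (le n)))
  ≤∞-fin⇒≤ {∞}       le with le 0
  ... | ()

  module _ {ℓ} (P : Pred ([0,∞] ℝ) ℓ) where

    Bounded : Set _
    Bounded = ∃[ u ] Σ[ 0≤u ∈ 0# ≤ u ] IsUpperBound (_≤∞_ ℝ) P (fin u 0≤u)

    -- Passing through True lowers the level of P to 0, where completeness is
    -- available; 0# is added because P may be empty.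
    finitePart : Pred Carrier 0ℓ
    finitePart x = True (dec (∃[ p ] P (fin x p))) ⊎ x ≈ 0#

    supremum-bounded : Bounded → ∃ (IsSupremum (_≤∞_ ℝ) P)
    supremum-bounded (u , 0≤u , ub) = fin σ 0≤σ , upper , least
      where
      sup : ∃ (IsSupremum _≤_ finitePart)
      sup = complete finitePart (0# , inj₂ refl)
        (u , λ { x (inj₁ w) → fin≤fin⁻¹ (ub _ (proj₂ (toWitness w))) ; x (inj₂ x≈0) → ≤.≤-respˡ-≈ (sym x≈0) 0≤u })
      σ = proj₁ sup

      0≤σ : 0# ≤ σ
      0≤σ = proj₁ (proj₂ sup) 0# (inj₂ refl)

      upper : IsUpperBound (_≤∞_ ℝ) P (fin σ 0≤σ)
      upper (fin x p) Px = fin≤fin (proj₁ (proj₂ sup) x (inj₁ (fromWitness (p , Px))))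
      upper ∞ P∞ with ub ∞ P∞
      ... | ()

      least : ∀ f → IsUpperBound (_≤∞_ ℝ) P f → _≤∞_ ℝ (fin σ 0≤σ) f
      least ∞         _   = ≤∞-top
      least (fin y q) ub′ = fin≤fin (proj₂ (proj₂ sup) y
        λ { x (inj₁ w) → fin≤fin⁻¹ (ub′ _ (proj₂ (toWitness w))) ; x (inj₂ x≈0) → ≤.≤-respˡ-≈ (sym x≈0) q })

    abstract
      supremum-∞ : ∃ (IsSupremum (_≤∞_ ℝ) P)
      supremum-∞ with dec Bounded
      ... | yes b = supremum-bounded b
      ... | no unbounded = ∞ , (λ _ _ → ≤∞-top) , λ { ∞ _ → ≤∞-top ; (fin y q) ub → ⊥-elim (unbounded (y , q , ub)) }

  abstract
    -- The infimum is obtained as the supremum of the lower bounds.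
    infimum-∞ : ∀ {ℓ} (P : Pred ([0,∞] ℝ) ℓ) → ∃ (IsInfimum (_≤∞_ ℝ) P)
    infimum-∞ P =
      let σ , ub , least = supremum-∞ (IsLowerBound (_≤∞_ ℝ) P)
      in σ , (λ e Pe → least e λ l lb → lb e Pe) , λ l lb → ub l lb

    infimum : (P : Pred Carrier 0ℓ) → ∃ P → ∃ (IsLowerBound _≤_ P) → ∃ (IsInfimum _≤_ P)
    infimum P (x , Px) bound =
      let σ , ub , least = complete (IsLowerBound _≤_ P) bound (x , λ l lb → lb x Px)
      in σ , (λ y Py → least y λ l lb → lb y Py) , λ l lb → ub l lb

  x≤abs : ∀ x → x ≤ abs ℝ x
  x≤abs x with ≤.total 0# x
  ... | inj₁ 0≤x = ≤.refl
  ... | inj₂ x≤0 = ≤.trans x≤0 (≤.≤-respˡ-≈ -0#≈0# (neg-mono-≤ x≤0))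

  0≤abs : ∀ x → 0# ≤ abs ℝ x
  0≤abs x with ≤.total 0# x
  ... | inj₁ 0≤x = 0≤x
  ... | inj₂ x≤0 = ≤.≤-respˡ-≈ -0#≈0# (neg-mono-≤ x≤0)

  abs-≤ : ∀ {x c} → x ≤ c → - x ≤ c → abs ℝ x ≤ c
  abs-≤ {x} x≤c -x≤c with ≤.total 0# x
  ... | inj₁ _ = x≤c
  ... | inj₂ _ = -x≤c

  diameter-bound : ∀ {U d 0≤d} → IsDiameter ℝ U (fin d 0≤d) → ∀ {x y} → U x → U y → x ≤ y + d
  diameter-bound {d = d} (ub , _) {x} {y} Ux Uy = ≤-certificate
    (0≤y-x (≤.trans (x≤abs (x - y)) (fin≤fin⁻¹ (ub _ (x , y , Ux , Uy , 0≤abs (x - y) , ≡.refl)))))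
    (solve 3 (λ x y d → (y :+ d) :- x := d :- (x :- y)) refl x y d)

  interval : Carrier → Carrier → Pred Carrier 0ℓ
  interval a c x = a ≤ x × x ≤ a + c

  interval-diameter : ∀ a {c} (0≤c : 0# ≤ c) → IsDiameter ℝ (interval a c) (fin c 0≤c)
  interval-diameter a {c} 0≤c = upper , least
    where
    difference : ∀ {x y} → interval a c x → interval a c y → x - y ≤ c
    difference {x} {y} (_ , x≤) (≤y , _) = ≤-certificate (+-nonNeg ℝ (0≤y-x x≤) (0≤y-x ≤y))
      (solve 4 (λ a c x y → c :- (x :- y) := ((a :+ c) :- x) :+ (y :- a)) refl a c x y)

    upper : ∀ e → _ → _≤∞_ ℝ e (fin c 0≤c)
    upper _ (x , y , Ux , Uy , p , ≡.refl) = fin≤fin (abs-≤ (difference Ux Uy)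
      (≤.≤-respˡ-≈ (solve 2 (λ x y → y :- x := :- (x :- y)) refl x y) (difference Uy Ux)))

    least : ∀ f → _ → _≤∞_ ℝ (fin c 0≤c) f
    least f ub = ≤∞-trans (fin≤fin {q = 0≤abs ((a + c) - a)} (≤.≤-respˡ-≈ (solve 2 (λ a c → (a :+ c) :- a := c) refl a c) (x≤abs ((a + c) - a))))
      (ub _ (a + c , a , (x≤x+y 0≤c , ≤.refl) , (≤.refl , x≤x+y 0≤c) , 0≤abs _ , ≡.refl))

  diameter-unique : ∀ {U d d′ 0≤d 0≤d′} → IsDiameter ℝ U (fin d 0≤d) → IsDiameter ℝ U (fin d′ 0≤d′) → d ≈ d′
  diameter-unique (ub , least) (ub′ , least′) = ≤.antisym (fin≤fin⁻¹ (least _ ub′)) (fin≤fin⁻¹ (least′ _ ub))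

  ι-numerator : ∀ q → ℚ.NonNegative q → ι ℤ.∣ ↥ q ∣ ≈ fromℚ ℝ q * ι (↧ₙ q)
  ι-numerator q@(mkℚ (+ n) _ _) _ = sym (fromℚ-↥ q)

  fromℚ-0 : fromℚ ℝ 0ℚ ≈ 0#
  fromℚ-0 = fromℚ-ℤ (+ 0)

  1∈RationalPowersBelow : ∀ {d t} → 0# ≤ t → RationalPowersBelow ℝ d t 1#
  1∈RationalPowersBelow 0≤t = 0ℚ , _ , ≤.≤-respˡ-≈ (sym fromℚ-0) 0≤t , 0≤1 , *-identityʳ 1#

  -- Comparison of b-th powers for q = a / b: 2^(-mb) ≤ 2^(-ka) ≤ d^a = w^b, where ka ≤ mb because k
  -- a / b ≤ k t ≤ m.
  rationalPower-lower : ∀ {d t k m} → h k ≤ d → t * ι k ≤ ι m → ∀ w → RationalPowersBelow ℝ d t w → h m ≤ w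
  rationalPower-lower {d} {t} {k} {m} hk≤d tk≤m w (q@record{} , q≥0 , q≤t , 0≤w , w^b≈d^a) =
    ^-cancel-≤ (ℚ.ℚ.denominator-1 q) (0≤h m) 0≤w (≤.trans (≤.reflexive (h-^ m b)) (≤.trans (h-anti-≤ ka≤mb)
      (≤.trans (≤.reflexive (sym (h-^ k a))) (≤.trans (^-mono-≤ a (0≤h k) hk≤d) (≤.reflexive (sym w^b≈d^a))))))
    where
    a = ℤ.∣ ↥ q ∣
    b = ↧ₙ q
    ka≤mb : k ℕ.* a ℕ.≤ m ℕ.* b
    ka≤mb = ι-cancel-≤ (≤.≤-respˡ-≈ (sym (×1-homo-* k a)) (≤.≤-respʳ-≈ (sym (×1-homo-* m b))
      (≤.≤-respˡ-≈ (trans (solve 3 (λ x k b → (x :* k) :* b := k :* (x :* b)) refl (fromℚ ℝ q) (ι k) (ι b)) (*-congˡ (sym (ι-numerator q q≥0))))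
        (*-monoʳ-≤ (ι b) (0≤ι b) (≤.trans (*-monoʳ-≤ (ι k) (0≤ι k) q≤t) tk≤m)))))

  power-lower : ∀ {d t k m} → 0# ≤ d → d ≤ 1# → 0# ≤ t → h k ≤ d → t * ι k ≤ ι m → ∃[ z ] Power ℝ d t z × h m ≤ z
  power-lower {d} {t} {k} {m} 0≤d d≤1 0≤t hk≤d tk≤m =
    let z , inf = infimum (RationalPowersBelow ℝ d t) (1# , 1∈RationalPowersBelow 0≤t)
                    (0# , λ { w (_ , _ , _ , 0≤w , _) → 0≤w })
    in z , power-≤1 0≤d d≤1 inf , proj₂ inf (h m) (rationalPower-lower {d} {t} {k} {m} hk≤d tk≤m)

  h-suc≱1 : ∀ n → ¬ (1# ≤ h (suc n))
  h-suc≱1 n 1≤h = <⇒≱ 0<1 (≤-certificate (+-nonNeg ℝ (+-nonNeg ℝ (0≤y-x 1≤h) (0≤y-x 1≤h)) (0≤y-x (≤.≤-respˡ-≈ (sym (h-split n)) (h≤1 n))))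
    (solve 1 (λ x → con (+ 0) :- con (+ 1) := ((x :- con (+ 1)) :+ (x :- con (+ 1))) :+ (con (+ 1) :- (x :+ x))) refl (h (suc n))))

  -- The diameters 2^(-bk) are used because their powers with exponent a / b are again powers of 2.
  power-upper : ∀ {d t z} q → ℚ.NonNegative q → fromℚ ℝ q ≤ t → ∀ k → d ≈ h (↧ₙ q ℕ.* suc k) →
                Power ℝ d t z → z ≤ h (ℤ.∣ ↥ q ∣ ℕ.* suc k)
  power-upper q@record{} q≥0 q≤t k d≈ (power-≥1 1≤d _) = ⊥-elim (h-suc≱1 (k ℕ.+ ℚ.ℚ.denominator-1 q ℕ.* suc k) (≤.≤-respʳ-≈ d≈ 1≤d))
  power-upper {d} q@record{} q≥0 q≤t k d≈ (power-≤1 _ _ (lb , _)) = lb (h (a ℕ.* suc k)) (q , q≥0 , q≤t , 0≤h (a ℕ.* suc k) , (begin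
    h (a ℕ.* suc k) ^ b      ≈⟨ h-^ (a ℕ.* suc k) b ⟩
    h (a ℕ.* suc k ℕ.* b)    ≈⟨ reflexive (≡.cong h (≡.trans (ℕ.*-comm (a ℕ.* suc k) b) (≡.trans (≡.cong (b ℕ.*_) (ℕ.*-comm a (suc k))) (≡.sym (ℕ.*-assoc b (suc k) a))))) ⟩
    h (b ℕ.* suc k ℕ.* a)    ≈⟨ h-^ (b ℕ.* suc k) a ⟨
    h (b ℕ.* suc k) ^ a      ≈⟨ ^-congˡ a d≈ ⟨
    d ^ a                    ∎))
    where
    a = ℤ.∣ ↥ q ∣
    b = ↧ₙ q

  abstract
    -- For a denominator B with B (t - s) ≥ 1, take p = ⌊t B⌋: then p + 1 > t B ≥ s B + 1 gives p >
    -- s B. The last clause speaks of the reduced numerator and denominator because these set the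
    -- scale of the covers below.
    rational-between : ∀ {s t} → 0# ≤ t → ¬ (t ≤ s) →
      ∃[ q ] ℚ.NonNegative q × fromℚ ℝ q ≤ t × ¬ (ι ℤ.∣ ↥ q ∣ ≤ s * ι (↧ₙ q))
    rational-between {s} {t} 0≤t t≰s = q , ℚ.normalize-nonNeg p (suc b) , q≤t , λ le → p+1≰ (p+1≤ le)
      where
      ε : Carrier
      ε = t - s
      0<ε : 0# < ε
      0<ε = 0<y-x t≰s
      b : ℕ
      b = proj₁ (archimedean (ε ⁻¹))
      B : Carrier
      B = ι (suc b)
      1≤Bε : 1# ≤ B * ε
      1≤Bε = ≤.≤-respˡ-≈ (trans (*-comm _ _) (⁻¹-inverseʳ ε (>⇒≉0 0<ε)))
        (*-monoʳ-≤ ε (proj₁ 0<ε) (≤.trans (proj₂ (archimedean (ε ⁻¹))) (ι-mono-≤ (ℕ.n≤1+n b))))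
      fl : ∃[ p ] ι p ≤ t * B × ¬ (ι (suc p) ≤ t * B)
      fl = floor (t * B) (*-nonNeg 0≤t (0≤ι (suc b)))
      p : ℕ
      p = proj₁ fl
      p+1≰ : ¬ (ι (suc p) ≤ t * B)
      p+1≰ = proj₂ (proj₂ fl)
      q : ℚ
      q = (+ p) ℚ./ suc b
      q*B≈p : fromℚ ℝ q * B ≈ ι p
      q*B≈p = fromℚ-/ (+ p) (suc b)
      q≤t : fromℚ ℝ q ≤ t
      q≤t = *-cancelʳ-≤ B (0<ι b) (≤.≤-respˡ-≈ (sym q*B≈p) (proj₁ (proj₂ fl)))

      0<den : ∀ r → 0# < ι (↧ₙ r)
      0<den record{ denominator-1 = m } = 0<ι m

      p+1≤ : ι ℤ.∣ ↥ q ∣ ≤ s * ι (↧ₙ q) → ι (suc p) ≤ t * B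
      p+1≤ le = ≤-certificate (+-nonNeg ℝ (0≤y-x (≤.≤-respˡ-≈ q*B≈p (*-monoʳ-≤ B (0≤ι (suc b))
          (*-cancelʳ-≤ (ι (↧ₙ q)) (0<den q) (≤.≤-respˡ-≈ (ι-numerator q (ℚ.normalize-nonNeg p (suc b))) le))))) (0≤y-x 1≤Bε))
        (solve 4 (λ t s B p → t :* B :- (con (+ 1) :+ p) := (s :* B :- p) :+ (B :* (t :- s) :- con (+ 1))) refl t s B (ι p))

  -- Escaping cylinders of total mass below 1

  module Avoidance (A : Digits) where

    factor : Bool → Carrier
    factor b = h (bit b)

    -- The mass, relative to the level-m cylinder containing it, of the cylinder obtained by appending τ.
    weight : ℕ → List Bool → Carrier
    weight m []      = 1#
    weight m (b ∷ τ) = factor (A m) * weight (suc m) τ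

    total : ℕ → List (List Bool) → Carrier
    total m []       = 0#
    total m (τ ∷ cs) = weight m τ + total m cs

    0≤weight : ∀ m τ → 0# ≤ weight m τ
    0≤weight m []      = 0≤1
    0≤weight m (b ∷ τ) = *-nonNeg (0≤h (bit (A m))) (0≤weight (suc m) τ)

    0≤total : ∀ m cs → 0# ≤ total m cs
    0≤total m []       = ≤.refl
    0≤total m (τ ∷ cs) = +-nonNeg ℝ (0≤weight m τ) (0≤total m cs)

    h-weight : ∀ m τ → h (count A m) * weight m τ ≈ h (count A (m ℕ.+ length τ))
    h-weight m []      = trans (*-identityʳ _) (reflexive (≡.cong (λ k → h (count A k)) (≡.sym (ℕ.+-identityʳ m))))
    h-weight m (b ∷ τ) = begin
      h (count A m) * (factor (A m) * weight (suc m) τ)   ≈⟨ *-assoc _ _ _ ⟨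
      (h (count A m) * factor (A m)) * weight (suc m) τ   ≈⟨ *-congʳ (h-+ (count A m) (bit (A m))) ⟨
      h (count A (suc m)) * weight (suc m) τ              ≈⟨ h-weight (suc m) τ ⟩
      h (count A (suc m ℕ.+ length τ))                    ≈⟨ reflexive (≡.cong (λ k → h (count A k)) (ℕ.+-suc m (length τ))) ⟨
      h (count A (m ℕ.+ suc (length τ)))                  ∎

    weight₀ : ∀ τ → weight 0 τ ≈ h (count A (length τ))
    weight₀ τ = trans (sym (*-identityˡ _)) (h-weight 0 τ)

    total-++ : ∀ m cs cs′ → total m (cs ++ cs′) ≈ total m cs + total m cs′
    total-++ m []       cs′ = sym (+-identityˡ _)
    total-++ m (τ ∷ cs) cs′ = trans (+-congˡ (total-++ m cs cs′)) (sym (+-assoc _ _ _))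

    []∈⇒1≤total : ∀ {m cs} → [] ∈ˡ cs → 1# ≤ total m cs
    []∈⇒1≤total {m} {_ ∷ cs} (here ≡.refl) = x≤x+y (0≤total m cs)
    []∈⇒1≤total {m} {τ ∷ cs} (there i)     = ≤.trans ([]∈⇒1≤total i)
      (≤.≤-respʳ-≈ (+-comm _ _) (x≤x+y (0≤weight m τ)))

    -- Each nonempty word passes to exactly one of the two derivatives and sheds its first factor;
    -- only dropped empty words make the inequality strict.
    total-derivative : ∀ m cs →
      factor (A m) * (total (suc m) (derivative false cs) + total (suc m) (derivative true cs)) ≤ total m cs
    total-derivative m [] = ≤.reflexive (trans (*-congˡ (+-identityˡ 0#)) (zeroʳ _))
    total-derivative m ([] ∷ cs) = ≤.trans (total-derivative m cs) (≤.≤-respʳ-≈ (+-comm _ _) (x≤x+y 0≤1))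
    total-derivative m ((false ∷ τ) ∷ cs) = ≤.≤-respˡ-≈
      (solve 4 (λ f w x y → f :* w :+ f :* (x :+ y) := f :* ((w :+ x) :+ y)) refl
        (factor (A m)) (weight (suc m) τ) (total (suc m) (derivative false cs)) (total (suc m) (derivative true cs)))
      (+-mono-≤ ≤.refl (total-derivative m cs))
    total-derivative m ((true ∷ τ) ∷ cs) = ≤.≤-respˡ-≈
      (solve 4 (λ f w x y → f :* w :+ f :* (x :+ y) := f :* (x :+ (w :+ y))) refl
        (factor (A m)) (weight (suc m) τ) (total (suc m) (derivative false cs)) (total (suc m) (derivative true cs)))
      (+-mono-≤ ≤.refl (total-derivative m cs))

    -- An infinite family of words is given by growing finite stages, so its total mass is
    -- controlled stage by stage, without infinite sums.
    Chain : (ℕ → List (List Bool)) → Set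
    Chain C = ∀ N → ∃[ L ] C (suc N) ≡ L ++ C N

    Chain-derivative : ∀ c {C} → Chain C → Chain (λ N → derivative c (C N))
    Chain-derivative c {C} chain N =
      let L , eq = chain N
      in derivative c L , ≡.trans (≡.cong (derivative c) eq) (derivative-++ c L (C N))

    total-chain : ∀ m {C} → Chain C → ∀ {M N} → M ℕ.≤′ N → total m (C M) ≤ total m (C N)
    total-chain m chain (ℕ.≤′-reflexive ≡.refl) = ≤.refl
    total-chain m {C} chain (ℕ.≤′-step {N} M≤N) =
      let L , eq = chain N
      in ≤.trans (total-chain m {C} chain M≤N) (≤.trans
           (≤.≤-respʳ-≈ (trans (+-comm _ _) (sym (total-++ m L (C N)))) (x≤x+y (0≤total m L)))
           (≤.reflexive (reflexive (≡.cong (total m) (≡.sym eq)))))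

    Light : ℕ → (ℕ → List (List Bool)) → Set
    Light m C = Chain C × (∀ N → ¬ (1# ≤ total m (C N)))

    -- The masses of the parts of a light family in the two halves of a cylinder
    -- add up to less than the mass of the cylinder, so some half is not filled.
    descend : ∀ m {C} → Light m C →
      ∃[ c ] (c ≡ true → A m ≡ true) × Light (suc m) (λ N → derivative c (C N))
    descend m {C} (chain , light) = go (A m) ≡.refl
      where
      go : ∀ b → A m ≡ b → ∃[ c ] (c ≡ true → b ≡ true) × Light (suc m) (λ N → derivative c (C N))
      -- Off `A` the digit must be 0. The factor is 1 there, so the part in the `false` half weighs
      -- no more than the whole family.
      go false Am = false , (λ ()) , Chain-derivative false chain , λ N 1≤ → light N
        (≤.trans 1≤ (≤.trans (≤.≤-respʳ-≈ (sym (trans (*-congʳ (reflexive (≡.cong factor Am))) (*-identityˡ _)))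
            (x≤x+y (0≤total (suc m) (derivative true (C N))))) (total-derivative m (C N))))
      go true Am with dec (∃[ N ] 1# ≤ total (suc m) (derivative false (C N)))
      ... | no none = false , (λ ()) , Chain-derivative false chain , λ N 1≤ → none (N , 1≤)
      ... | yes (N₀ , 1≤₀) = true , (λ _ → ≡.refl) , Chain-derivative true chain , λ N₁ 1≤₁ →
        -- A common later stage at which both halves are filled: their average, at least 1, bounds
        -- the total from below.
        let N = N₀ ℕ.+ N₁
            le₀ = ≤.trans 1≤₀ (total-chain (suc m) {λ N → derivative false (C N)} (Chain-derivative false chain) (ℕ.≤⇒≤′ (ℕ.m≤m+n N₀ N₁)))
            le₁ = ≤.trans 1≤₁ (total-chain (suc m) {λ N → derivative true (C N)} (Chain-derivative true chain) (ℕ.≤⇒≤′ (ℕ.m≤n+m N₁ N₀)))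
        in light N (≤.trans (≤.reflexive (sym (trans (*-congʳ (trans (reflexive (≡.cong factor Am)) (*-identityʳ ½)))
                                         (trans (distribˡ _ _ _) (trans (+-cong (*-identityʳ _) (*-identityʳ _)) ½+½≈1)))))
             (≤.trans (*-monoˡ-≤ (factor (A m)) (0≤h (bit (A m))) (+-mono-≤ le₀ le₁)) (total-derivative m (C N))))

    module _ (C : ℕ → List (List Bool)) (light : Light 0 C) where

      branch : ∀ m → Σ[ D ∈ (ℕ → List (List Bool)) ] Light m D
      branch zero    = C , light
      branch (suc m) = _ , proj₂ (proj₂ (descend m (proj₂ (branch m))))

      avoiding : Digits
      avoiding m = proj₁ (descend m (proj₂ (branch m)))

      avoiding-supported : SupportedOn A avoiding
      avoiding-supported m = proj₁ (proj₂ (descend m (proj₂ (branch m))))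

      -- Reading `τ` along `avoiding` would leave the empty word, of weight 1, in a light family.
      avoids-from : ∀ τ m {N} → τ ∈ˡ proj₁ (branch m) N → ¬ OccursAt m τ avoiding
      avoids-from []      m {N} τ∈ _ = proj₂ (proj₂ (branch m)) N ([]∈⇒1≤total τ∈)
      avoids-from (b ∷ τ) m {N} τ∈ (≡.refl , occ) = avoids-from τ (suc m) {N} (∈-derivative b τ∈) occ

      avoiding-avoids : ∀ {τ N} → τ ∈ˡ C N → ¬ OccursAt 0 τ avoiding
      avoiding-avoids {τ} τ∈ = avoids-from τ 0 τ∈

    -- A number `l` too large to be a prefix of length `n` yields the zero word, so that every entry
    -- of a window has length `n` and hence the same weight.
    cylinder : ℕ → ℕ → List Bool
    cylinder n l with dec (∃[ d ] leading d n ≡ l)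
    ... | yes (d , _) = segment 0 n d
    ... | no _        = segment 0 n (λ _ → false)

    length-cylinder : ∀ n l → length (cylinder n l) ≡ n
    length-cylinder n l with dec (∃[ d ] leading d n ≡ l)
    ... | yes (d , _) = length-segment 0 n d
    ... | no _        = length-segment 0 n (λ _ → false)

    cylinder-occurs : ∀ n d → OccursAt 0 (cylinder n (leading d n)) d
    cylinder-occurs n d with dec (∃[ e ] leading e n ≡ leading d n)
    ... | yes (e , eq) = segment-occurs 0 n λ i _ i<n → leading-injective n (≡.sym eq) i i<n
    ... | no none      = ⊥-elim (none (d , ≡.refl))

    -- The cylinders numbered from l - 2 to l + 2; truncated subtraction only repeats the cylinder
    -- 0.
    window : ℕ → ℕ → List (List Bool)
    window n l = List.map (λ o → cylinder n ((l ℕ.+ o) ℕ.∸ 2)) (List.upTo 5)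

    ∈-window : ∀ n l k → l ℕ.≤ k ℕ.+ 2 → k ℕ.≤ l ℕ.+ 2 → cylinder n k ∈ˡ window n l
    ∈-window n l k l≤k+2 k≤l+2 = ≡.subst (λ m → cylinder n m ∈ˡ window n l)
      (≡.trans (≡.cong (ℕ._∸ 2) (ℕ.m+[n∸m]≡n l≤k+2)) (ℕ.m+n∸n≡m k 2))
      (∈-map⁺ (λ o → cylinder n ((l ℕ.+ o) ℕ.∸ 2)) (∈-upTo⁺ (s≤s (ℕ.≤-trans (ℕ.∸-monoˡ-≤ l (ℕ.+-monoˡ-≤ 2 k≤l+2))
        (ℕ.≤-reflexive (≡.trans (≡.cong (ℕ._∸ l) (≡.trans (ℕ.+-assoc l 2 2) (ℕ.+-comm l 4))) (ℕ.m+n∸n≡m 4 l)))))))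

    five : Carrier
    five = 1# + (1# + (1# + (1# + 1#)))

    0≤five : 0# ≤ five
    0≤five = +-nonNeg ℝ 0≤1 (+-nonNeg ℝ 0≤1 (+-nonNeg ℝ 0≤1 (+-nonNeg ℝ 0≤1 0≤1)))

    total-window : ∀ n l → total 0 (window n l) ≈ five * h (count A n)
    total-window n l = trans (+-cong (w _) (+-cong (w _) (+-cong (w _) (+-cong (w _) (+-cong (w _) refl)))))
      (solve 1 (λ x → x :+ (x :+ (x :+ (x :+ (x :+ con (+ 0))))) := (con (+ 1) :+ (con (+ 1) :+ (con (+ 1) :+ (con (+ 1) :+ con (+ 1))))) :* x) refl (h (count A n)))
      where
      w : ∀ k → weight 0 (cylinder n k) ≈ h (count A n)
      w k = trans (weight₀ (cylinder n k)) (reflexive (≡.cong (λ m → h (count A m)) (length-cylinder n k)))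

    -- One unit of `h n` comes from the distance of the values and one from truncating `e`.
    leading-close : ∀ {d e} n → val d ≤ val e + h n → leading d n ℕ.≤ leading e n ℕ.+ 2
    leading-close {d} {e} n le = ι-cancel-≤ (*-cancelʳ-≤ (h n) (0<h n)
      (≤.trans (truncation≤val d n) (≤.trans le (≤.trans (+-mono-≤ (val≤truncation e n) ≤.refl)
        (≤.reflexive (sym (trans (*-congʳ (×-homo-+ 1# (leading e n) 2))
          (solve 2 (λ l h → (l :+ (con (+ 1) :+ (con (+ 1) :+ con (+ 0)))) :* h := (l :* h :+ h) :+ h) refl (ι (leading e n)) (h n)))))))))

    module _ (n : ℕ) (V : Pred Digits 0ℓ) where

      -- A window around any one member serves the whole of `V` once `V` has values within `h n` of
      -- each other. An empty `V` costs nothing.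
      cylinders : List (List Bool)
      cylinders with dec (∃ V)
      ... | yes (d , _) = window n (leading d n)
      ... | no _        = []

      total-cylinders : total 0 cylinders ≤ five * h (count A n)
      total-cylinders with dec (∃ V)
      ... | yes (d , _) = ≤.reflexive (total-window n (leading d n))
      ... | no _        = *-nonNeg 0≤five (0≤h (count A n))

      cylinders-cover : (∀ {d e} → V d → V e → val d ≤ val e + h n) →
                        ∀ {d} → V d → ∃[ τ ] τ ∈ˡ cylinders × OccursAt 0 τ d
      cylinders-cover small {d} Vd with dec (∃ V)
      ... | yes (e , Ve) = cylinder n (leading d n) ,
            ∈-window n (leading e n) (leading d n) (leading-close n (small Ve Vd)) (leading-close n (small Vd Ve)) ,
            cylinder-occurs n d
      ... | no none = ⊥-elim (none (d , Vd))

  -- Upper bound for the dimension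

  module UpperBound (A : Digits) where

    module _ (n : ℕ) where

      dyadic : ℕ → Pred Carrier 0ℓ
      dyadic l = interval (ι l * h n) (h n)

      -- The finite cover is padded with empty sets, whose diameter powers are 0 for every exponent.
      dyadics : List ℕ → ℕ → Pred Carrier 0ℓ
      dyadics []       i       = λ _ → ⊥
      dyadics (l ∷ ls) zero    = dyadic l
      dyadics (l ∷ ls) (suc i) = dyadics ls i

      dyadics-cover : ∀ {ls l x} → l ∈ˡ ls → dyadic l x → ⋃ ℕ (dyadics ls) x
      dyadics-cover (here ≡.refl) x∈ = 0 , x∈
      dyadics-cover (there l∈)    x∈ = let i , x∈′ = dyadics-cover l∈ x∈ in suc i , x∈′

      dyadics-cases : ∀ ls i → (∃[ l ] dyadics ls i ≡ dyadic l) ⊎ (∀ x → ¬ dyadics ls i x)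
      dyadics-cases []       i       = inj₂ λ _ ()
      dyadics-cases (l ∷ ls) zero    = inj₁ (l , ≡.refl)
      dyadics-cases (l ∷ ls) (suc i) = dyadics-cases ls i

      dyadics-beyond : ∀ ls i → length ls ℕ.≤ i → ∀ x → ¬ dyadics ls i x
      dyadics-beyond []       i       le       x ()
      dyadics-beyond (l ∷ ls) (suc i) (s≤s le) = dyadics-beyond ls i le

      empty-diameter : ∀ {U : Pred Carrier 0ℓ} → (∀ x → ¬ U x) → IsDiameter ℝ U (0∞ ℝ)
      empty-diameter none = (λ { _ (x , y , Ux , _) → ⊥-elim (none x Ux) }) , λ f _ → 0≤∞ f

      dyadics-diameter : ∀ ls i → ∃[ d ] ∃[ 0≤d ] IsDiameter ℝ (dyadics ls i) (fin d 0≤d) × d ≤ h n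
      dyadics-diameter ls i with dyadics-cases ls i
      ... | inj₁ (l , eq) = h n , 0≤h n , ≡.subst (λ U → IsDiameter ℝ U (fin (h n) (0≤h n))) (≡.sym eq) (interval-diameter _ (0≤h n)) , ≤.refl
      ... | inj₂ none = 0# , ≤.refl , empty-diameter none , 0≤h n

    +∞-mono : ∀ {e f x y p q} → _≤∞_ ℝ e (fin x p) → _≤∞_ ℝ f (fin y q) → _≤∞_ ℝ (_+∞_ ℝ e f) (fin (x + y) (+-nonNeg ℝ p q))
    +∞-mono (fin≤fin a) (fin≤fin b) = fin≤fin (+-mono-≤ a b)

    partialSum-≤ : ∀ {c : ℕ → [0,∞] ℝ} {w} (0≤w : 0# ≤ w) L →
      (∀ i → _≤∞_ ℝ (c i) (fin w 0≤w)) → (∀ i → L ℕ.≤ i → _≤∞_ ℝ (c i) (0∞ ℝ)) →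
      ∀ N → _≤∞_ ℝ (partialSum ℝ c N) (fin (ι (N ℕ.⊓ L) * w) (*-nonNeg (0≤ι (N ℕ.⊓ L)) 0≤w))
    partialSum-≤ 0≤w L small null zero = fin≤fin (≤.reflexive (sym (zeroˡ _)))
    partialSum-≤ {c} {w} 0≤w L small null (suc N) with N ℕ.<? L
    ... | yes N<L = ≤∞-trans (+∞-mono (partialSum-≤ {c} 0≤w L small null N) (small N))
          (fin≤fin (≤.reflexive (trans (+-congʳ (*-congʳ (×-congˡ (ℕ.m≤n⇒m⊓n≡m (ℕ.<⇒≤ N<L)))))
            (trans (solve 2 (λ n w → n :* w :+ w := (con (+ 1) :+ n) :* w) refl (ι N) w) (*-congʳ (×-congˡ (≡.sym (ℕ.m≤n⇒m⊓n≡m N<L))))))))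
    ... | no N≮L = ≤∞-trans (+∞-mono (partialSum-≤ {c} 0≤w L small null N) (null N L≤N))
          (fin≤fin (≤.reflexive (trans (+-identityʳ _) (*-congʳ (×-congˡ (≡.trans (ℕ.m≥n⇒m⊓n≡n L≤N) (≡.sym (ℕ.m≥n⇒m⊓n≡n (ℕ.m≤n⇒m≤1+n L≤N)))))))))
      where
      L≤N = ℕ.≮⇒≥ N≮L

    module _ {s t} (sparse : ∀ n → ι (count A n) ≤ s * ι n) (0≤t : 0# ≤ t) (t≰s : ¬ (t ≤ s)) where

      private
        rational = rational-between {s} {t} 0≤t t≰s

      q : ℚ
      q = proj₁ rational

      a b : ℕ
      a = ℤ.∣ ↥ q ∣
      b = ↧ₙ q

      ε : Carrier
      ε = ι a - s * ι b

      0<ε : 0# < ε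
      0<ε = 0<y-x (proj₂ (proj₂ (proj₂ rational)))

      -- By `sparse`, a k - count (b k) ≥ k (a - s b) = k ε. The excess `m` later becomes the bound
      -- 2⁻ᵐ for the sum over the cover.
      gain : ∀ m k → ι m ≤ ι k * ε → count A (b ℕ.* k) ℕ.+ m ℕ.≤ a ℕ.* k
      gain m k m≤ = ι-cancel-≤ (≤-certificate (+-nonNeg ℝ (0≤y-x (≤.≤-respʳ-≈ (*-congˡ (×1-homo-* b k)) (sparse (b ℕ.* k)))) (0≤y-x m≤))
        (trans (+-cong (×1-homo-* a k) (-‿cong (×-homo-+ 1# (count A (b ℕ.* k)) m)))
          (solve 6 (λ a k s b c m → a :* k :- (c :+ m) := (s :* (b :* k) :- c) :+ (k :* (a :- s :* b) :- m)) refl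
            (ι a) (ι k) s (ι b) (ι (count A (b ℕ.* k))) (ι m))))

      abstract
        -- Taking k ≥ m / ε provides the gain and adding `n` makes the cover fine enough; the
        -- successor keeps the diameters below 1, as `power-upper` requires.
        level : ∀ m n → ∃[ k ] count A (b ℕ.* suc k) ℕ.+ m ℕ.≤ a ℕ.* suc k × n ℕ.≤ b ℕ.* suc k
        level m n = k₀ ℕ.+ n , gain m k (≤.≤-respˡ-≈ undo (*-monoʳ-≤ ε (proj₁ 0<ε)
              (≤.trans (proj₂ (archimedean (ι m * ε ⁻¹))) (ι-mono-≤ (ℕ.m≤n⇒m≤1+n (ℕ.m≤m+n k₀ n)))))) ,
            ℕ.≤-trans (ℕ.≤-trans (ℕ.m≤n+m n k₀) (ℕ.n≤1+n _)) (large q k)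
          where
          k₀ : ℕ
          k₀ = proj₁ (archimedean (ι m * ε ⁻¹))
          k : ℕ
          k = suc (k₀ ℕ.+ n)
          undo : (ι m * ε ⁻¹) * ε ≈ ι m
          undo = trans (*-assoc _ _ _) (trans (*-congˡ (trans (*-comm _ _) (⁻¹-inverseʳ ε (>⇒≉0 0<ε)))) (*-identityʳ _))
          large : ∀ r k → k ℕ.≤ ↧ₙ r ℕ.* k
          large r@record{} k = ℕ.m≤n*m k (↧ₙ r)

      module Cover (m n₀ : ℕ) where
        k n : ℕ
        k = proj₁ (level m n₀)
        n = b ℕ.* suc k

        ls : List ℕ
        ls = leadings A n

        U : ℕ → Pred Carrier 0ℓ
        U = dyadics n ls

        w : Carrier
        w = h (a ℕ.* suc k)

        c : ℕ → [0,∞] ℝ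
        c i = proj₁ (supremum-∞ (λ e → ∃ (U i) × (∃[ d ] ∃[ 0≤d ] ∃[ z ] ∃[ 0≤z ]
                IsDiameter ℝ (U i) (fin d 0≤d) × Power ℝ d t z × e ≡ fin z 0≤z)))

        c-power : ∀ i → IsDiameterPower ℝ (U i) t (c i)
        c-power i = proj₂ (supremum-∞ _)

        c-null : ∀ i → (∀ x → ¬ U i x) → _≤∞_ ℝ (c i) (0∞ ℝ)
        c-null i none = proj₂ (c-power i) _ λ { _ ((x , Ux) , _) → ⊥-elim (none x Ux) }

        c-dyadic : ∀ i l → U i ≡ dyadic n l → _≤∞_ ℝ (c i) (fin w (0≤h (a ℕ.* suc k)))
        c-dyadic i l eq = proj₂ (c-power i) _ λ { _ (_ , d , 0≤d , z , 0≤z , diam , pow , ≡.refl) → fin≤fin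
          (power-upper q (proj₁ (proj₂ rational)) (proj₁ (proj₂ (proj₂ rational))) k
            (diameter-unique (≡.subst (λ V → IsDiameter ℝ V (fin d 0≤d)) eq diam) (interval-diameter (ι l * h n) (0≤h n))) pow) }

        c-≤ : ∀ i → _≤∞_ ℝ (c i) (fin w (0≤h (a ℕ.* suc k)))
        c-≤ i = [ (λ (l , eq) → c-dyadic i l eq) , (λ none → ≤∞-trans (c-null i none) (0≤∞ (fin w (0≤h (a ℕ.* suc k))))) ]′
                  (dyadics-cases n ls i)

        series = supremum-∞ (λ e → ∃[ N ] e ≡ partialSum ℝ c N)

        -- There are 2^count intervals, each contributing at most 2^(-a (k + 1)) ≤ 2^(-count - m).
        total-≤ : ι (length ls) * w ≤ h m
        total-≤ = ≤.trans (*-mono-≤ (0≤ι (length ls)) (≤.reflexive (×-congˡ (length-leadings A n))) (0≤h (a ℕ.* suc k))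
                    (h-anti-≤ (proj₁ (proj₂ (level m n₀)))))
                  (≤.reflexive (trans (*-congˡ (h-+ (count A n) m)) (trans (sym (*-assoc _ _ _)) (trans (*-congʳ (ι2^n*h≈1 (count A n))) (*-identityˡ _)))))

        series-≤ : _≤∞_ ℝ (proj₁ series) (fin (h m) (0≤h m))
        series-≤ = proj₂ (proj₂ series) _ λ { _ (N , ≡.refl) →
          ≤∞-trans (partialSum-≤ {c} (0≤h (a ℕ.* suc k)) (length ls) c-≤ (λ i L≤i → c-null i (dyadics-beyond n ls i L≤i)) N)
            (fin≤fin (≤.trans (*-monoʳ-≤ w (0≤h (a ℕ.* suc k)) (ι-mono-≤ (ℕ.m⊓n≤n N (length ls)))) total-≤)) }

        covers : ∀ {E δ} → E ⊆ CantorSet A → h n₀ ≤ δ → IsCover ℝ E δ U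
        covers E⊆ hn₀≤δ =
          (λ x∈ → let d , supp , x≈ = E⊆ x∈ in dyadics-cover n (leading∈leadings supp n)
            (≤.≤-respʳ-≈ (sym x≈) (truncation≤val d n) , ≤.≤-respˡ-≈ (sym x≈) (val≤truncation d n))) ,
          λ i → let d , 0≤d , diam , d≤ = dyadics-diameter n ls i
                in d , 0≤d , diam , ≤.trans d≤ (≤.trans (h-anti-≤ (proj₂ (proj₂ (level m n₀)))) hn₀≤δ)

      -- The covers bound each premeasure by 2⁻ᵐ for every `m`, at every scale δ.
      measure-zero : ∀ {E} → E ⊆ CantorSet A → IsHausdorffMeasure ℝ E t (0∞ ℝ)
      measure-zero E⊆ = (λ { e (δ , 0<δ , lb , _) → let n₀ , hn₀≤δ = h-small 0<δ in
          ≤∞-fin⇒≤ λ m → let open Cover m n₀ in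
            ≤∞-trans (lb _ (U , c , covers E⊆ hn₀≤δ , c-power , proj₂ series)) series-≤ }) ,
        λ f _ → 0≤∞ f

  -- Choice of the points and selection of the basis

  module Construction (ac : ∀ a b r → AxiomOfChoice a b r) (ch : ContinuumHypothesis ℝ) (A : Digits)
                      (unbounded : ∀ i → ∃[ n ] i ℕ.≤ count A n)
                      (k : ℕ) (gap : ∀ n → ∃[ j ] j ℕ.< k × A (n ℕ.+ j) ≡ true) where

    open Avoidance A

    Enumerates : (ℕ → Carrier) → Pred Carrier 0ℓ → Set
    Enumerates u S = ∀ x → x ∈ S → ∃[ k ] x ≈ u k

    module _ (u : ℕ → Carrier) where

      evaluate : List (ℚ × ℕ) → Carrier
      evaluate []             = 0#
      evaluate ((q , i) ∷ ts) = fromℚ ℝ q * u i + evaluate ts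

      -- Inverts the injective code of a formal combination by excluded middle; numbers that are not
      -- codes get the value `0#`.
      spanEnumeration : ℕ → Carrier
      spanEnumeration n with dec (∃[ ts ] encodeBits (unary (encodeTerms ts)) ≡ n)
      ... | yes (ts , _) = evaluate ts
      ... | no _         = 0#

      spanEnumeration-encode : ∀ ts → spanEnumeration (encodeBits (unary (encodeTerms ts))) ≡ evaluate ts
      spanEnumeration-encode ts with dec (∃[ ss ] encodeBits (unary (encodeTerms ss)) ≡ encodeBits (unary (encodeTerms ts)))
      ... | yes (ss , eq) = ≡.cong evaluate (encodeTerms-injective ss ts (unary-injective _ _ (encodeBits-injective _ _ eq)))
      ... | no none       = ⊥-elim (none (ts , ≡.refl))

      Span-term : ∀ {S} → Enumerates u S → ∀ {x} → Span S x → ∃[ ts ] x ≈ evaluate ts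
      Span-term enum (span-0 x≈0) = [] , x≈0
      Span-term enum (span-∷ {v = v} q v∈S y∈ eq) =
        let i , v≈ = enum v v∈S
            ts , y≈ = Span-term enum y∈
        in (q , i) ∷ ts , trans eq (+-cong (*-congˡ v≈) y≈)

      Span-enumerable : ∀ {S} → Enumerates u S → Enumerates spanEnumeration (Span S)
      Span-enumerable enum x x∈ =
        let ts , x≈ = Span-term enum x∈
        in encodeBits (unary (encodeTerms ts)) , trans x≈ (reflexive (≡.sym (spanEnumeration-encode ts)))

    -- Predicates up to ≐, with the equality lifted to the level of the carrier.
    predicates : Setoid (lsuc 0ℓ) (lsuc 0ℓ)
    predicates = record
      { Carrier = Pred Carrier 0ℓ
      ; _≈_     = λ P Q → Lift (lsuc 0ℓ) (P ≐ Q)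
      ; isEquivalence = record
        { refl  = lift ≐-refl
        ; sym   = λ p → lift (≐-sym (Level.lower p))
        ; trans = λ p q → lift (≐-trans (Level.lower p) (Level.lower q))
        }
      }

    abstract
      -- Stating the relation as `∃ P → P x` makes it total, so one function chooses from all
      -- predicates. With propositional equality on the target, equivalent predicates receive
      -- identical elements, and no predicate has to respect `_≈_`.
      choice : Σ[ f ∈ Func predicates (≡.setoid Carrier) ] ((P : Pred Carrier 0ℓ) → ∃ P → P (Func.to f P))
      choice = ac (lsuc 0ℓ) 0ℓ 0ℓ predicates (≡.setoid Carrier) (λ (P : Pred Carrier 0ℓ) x → ∃ P → P x)
        (λ { (lift (P⊆Q , Q⊆P)) f (y , Qy) → P⊆Q (f (y , Q⊆P Qy)) })
        (λ { ≡.refl f → f })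
        λ P → inhabitant P (dec (∃ P))
        where
        inhabitant : (P : Pred Carrier 0ℓ) → Dec (∃ P) → ∃[ x ] (∃ P → P x)
        inhabitant P (yes (x , Px)) = x , λ _ → Px
        inhabitant P (no none)      = 0# , λ p → ⊥-elim (none p)

    choose : Pred Carrier 0ℓ → Carrier
    choose = Func.to (proj₁ choice)

    choose-∈ : (P : Pred Carrier 0ℓ) → ∃ P → P (choose P)
    choose-∈ = proj₂ choice

    choose-ext : ∀ {P Q} → P ≐ Q → choose P ≡ choose Q
    choose-ext P≐Q = Func.cong (proj₁ choice) (lift P≐Q)

    ω₁ : StrictTotalOrder 0ℓ 0ℓ 0ℓ
    ω₁ = proj₁ ch

    module W = StrictTotalOrder ω₁

    open IsFirstUncountableOrdinal (proj₁ (proj₂ ch)) using (wellFounded; countable-<)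

    module 𝒫ℕ↔ℝ = Bijection (proj₁ (proj₂ (proj₂ ch)))
    module ℝ↔ω₁ = Bijection (proj₂ (proj₂ (proj₂ ch)))

    real : W.Carrier → Carrier
    real = ℝ↔ω₁.to⁻

    real-cong : ∀ {w w′} → w W.≈ w′ → real w ≈ real w′
    real-cong w≈w′ = ℝ↔ω₁.injective (W.Eq.trans (proj₂ (ℝ↔ω₁.strictlySurjective _)) (W.Eq.trans w≈w′ (W.Eq.sym (proj₂ (ℝ↔ω₁.strictlySurjective _)))))

    real-surjective : ∀ x → x ≈ real (ℝ↔ω₁.to x)
    real-surjective x = ℝ↔ω₁.injective (W.Eq.sym (proj₂ (ℝ↔ω₁.strictlySurjective _)))

    -- The use of CH: every set of codes, hence every countable union of cylinders, has an index in
    -- ω₁.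
    family : W.Carrier → Pred ℕ 0ℓ
    family w = 𝒫ℕ↔ℝ.to⁻ (real w)

    family-cong : ∀ {w w′} → w W.≈ w′ → family w ≐ family w′
    family-cong w≈w′ = 𝒫ℕ↔ℝ.injective (trans (proj₂ (𝒫ℕ↔ℝ.strictlySurjective _)) (trans (real-cong w≈w′) (sym (proj₂ (𝒫ℕ↔ℝ.strictlySurjective _)))))

    family-surjective : ∀ P → ∃[ w ] family w ≐ P
    family-surjective P = ℝ↔ω₁.to (𝒫ℕ↔ℝ.to P) ,
      𝒫ℕ↔ℝ.injective (trans (proj₂ (𝒫ℕ↔ℝ.strictlySurjective _)) (sym (real-surjective (𝒫ℕ↔ℝ.to P))))

    -- P stands for the union of the cylinders with codes in P.
    Escapes : Pred ℕ 0ℓ → Pred Carrier 0ℓ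
    Escapes P x = ∃[ d ] SupportedOn A d × x ≈ val d × (∀ τ → OccursAt 0 τ d → ¬ P (encodeBits τ))

    Candidate : W.Carrier → Pred Carrier 0ℓ → Pred Carrier 0ℓ
    Candidate w S x = Escapes (family w) x × ¬ Span S x

    Candidate-mono : ∀ {w w′ S S′} → family w′ ⊆ family w → S′ ⊆ S → Candidate w S ⊆ Candidate w′ S′
    Candidate-mono F S′⊆S ((d , supp , x≈ , esc) , new) = (d , supp , x≈ , λ τ occ p → esc τ occ (F p)) , λ x∈ → new (Span-mono S′⊆S x∈)

    -- If there is no candidate the value is arbitrary; restriction to E and the greedy selection
    -- later remove what is unsuitable.
    point-acc : ∀ w → Acc W._<_ w → Carrier
    point-acc w (acc rs) = choose (Candidate w λ x → ∃[ β ] Σ[ β<w ∈ β W.< w ] x ≈ point-acc β (rs β<w))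

    -- The value depends neither on the accessibility proof nor on the representative of `w`: by
    -- induction the candidate predicates are equivalent, and `choose` is extensional.
    point-acc-cong : ∀ {w w′} (a : Acc W._<_ w) (a′ : Acc W._<_ w′) → w W.≈ w′ → point-acc w a ≡ point-acc w′ a′
    point-acc-cong {w} {w′} (acc rs) (acc rs′) w≈w′ = choose-ext
      ( Candidate-mono {w} {w′} (proj₂ (family-cong w≈w′))
          (λ { (β , lt , x≈) → β , W.<-respʳ-≈ (W.Eq.sym w≈w′) lt ,
                 trans x≈ (reflexive (point-acc-cong (rs′ lt) (rs (W.<-respʳ-≈ (W.Eq.sym w≈w′) lt)) W.Eq.refl)) })
      , Candidate-mono {w′} {w} (proj₁ (family-cong w≈w′))
          (λ { (β , lt , x≈) → β , W.<-respʳ-≈ w≈w′ lt ,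
                 trans x≈ (reflexive (point-acc-cong (rs lt) (rs′ (W.<-respʳ-≈ w≈w′ lt)) W.Eq.refl)) }))

    point : W.Carrier → Carrier
    point w = point-acc w (wellFounded w)

    point-cong : ∀ {w w′} → w W.≈ w′ → point w ≈ point w′
    point-cong {w} {w′} w≈w′ = reflexive (point-acc-cong (wellFounded w) (wellFounded w′) w≈w′)

    Earlier : W.Carrier → Pred Carrier 0ℓ
    Earlier w x = ∃[ β ] β W.< w × x ≈ point β

    point-acc-candidate : ∀ w (a : Acc W._<_ w) → ∃ (Candidate w (Earlier w)) → Candidate w (Earlier w) (point-acc w a)
    point-acc-candidate w (acc rs) (x , cand) = Candidate-mono {w} {w} {Earlier′} {Earlier w} (λ p → p)
      (λ { (β , lt , x≈) → β , lt , trans x≈ (reflexive (point-acc-cong (wellFounded β) (rs lt) W.Eq.refl)) })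
      (choose-∈ (Candidate w Earlier′) (x , Candidate-mono {w} {w} {Earlier w} {Earlier′} (λ p → p)
        (λ { (β , lt , x≈) → β , lt , trans x≈ (reflexive (point-acc-cong (rs lt) (wellFounded β) W.Eq.refl)) }) cand))
      where
      Earlier′ : Pred Carrier 0ℓ
      Earlier′ x = ∃[ β ] Σ[ β<w ∈ β W.< w ] x ≈ point-acc β (rs β<w)

    point-candidate : ∀ w → ∃ (Candidate w (Earlier w)) → Candidate w (Earlier w) (point w)
    point-candidate w = point-acc-candidate w (wellFounded w)

    earlierEnumeration : W.Carrier → ℕ → Carrier
    earlierEnumeration w n with dec (∃[ β ] Injection.to (countable-< w) β ≡ n)
    ... | yes ((β , _) , _) = point β
    ... | no _              = 0#

    earlier-enumerable : ∀ w → Enumerates (earlierEnumeration w) (Earlier w)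
    earlier-enumerable w x (β , β<w , x≈) = Injection.to (countable-< w) (β , β<w) , trans x≈ same
      where
      same : point β ≈ earlierEnumeration w (Injection.to (countable-< w) (β , β<w))
      same with dec (∃[ γ ] Injection.to (countable-< w) γ ≡ Injection.to (countable-< w) (β , β<w))
      ... | yes (γ , eq) = point-cong (W.Eq.sym (Injection.injective (countable-< w) eq))
      ... | no none      = ⊥-elim (none ((β , β<w) , ≡.refl))

    CantorSet-resp : CantorSet A Respects _≈_
    CantorSet-resp x≈y (d , supp , x≈) = d , supp , trans (sym x≈y) x≈

    -- Elements outside E become `0#`, which lies in every span and is therefore never selected.
    restrict : Carrier → Carrier
    restrict x with dec (CantorSet A x)
    ... | yes _ = x
    ... | no _  = 0#

    restrict-∈ : ∀ {x} → CantorSet A x → restrict x ≈ x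
    restrict-∈ {x} x∈ with dec (CantorSet A x)
    ... | yes _ = refl
    ... | no x∉ = ⊥-elim (x∉ x∈)

    restrict-∉ : ∀ {x} → ¬ CantorSet A x → restrict x ≈ 0#
    restrict-∉ {x} x∉ with dec (CantorSet A x)
    ... | yes x∈ = ⊥-elim (x∉ x∈)
    ... | no _   = refl

    restrict-cong : ∀ {x y} → x ≈ y → restrict x ≈ restrict y
    restrict-cong {x} {y} x≈y = case (dec (CantorSet A x))
      where
      case : Dec (CantorSet A x) → restrict x ≈ restrict y
      case (yes x∈) = trans (restrict-∈ x∈) (trans x≈y (sym (restrict-∈ (CantorSet-resp x≈y x∈))))
      case (no x∉)  = trans (restrict-∉ x∉) (sym (restrict-∉ λ y∈ → x∉ (CantorSet-resp (sym x≈y) y∈)))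

    restrict-Span : ∀ {S x} → S x → Span S (restrict x)
    restrict-Span {S} {x} x∈S with dec (CantorSet A x)
    ... | yes _ = Span-generator x∈S
    ... | no _  = span-0 refl

    -- The left copy of ω₁ lists the points and precedes the right copy, which lists all of E for
    -- the sake of spanning.
    vector : W.Carrier ⊎ W.Carrier → Carrier
    vector i = restrict ([ point , real ]′ i)

    indices : StrictTotalOrder 0ℓ 0ℓ 0ℓ
    indices = ⊎-<-strictTotalOrder {d = 0ℓ} {0ℓ} {0ℓ} ω₁ ω₁

    vector-cong : ∀ {i j} → StrictTotalOrder._≈_ indices i j → vector i ≈ vector j
    vector-cong (inj₁ w≈) = restrict-cong (point-cong w≈)
    vector-cong (inj₂ w≈) = restrict-cong (real-cong w≈)

    open Greedy indices (⊎-<-wellFounded wellFounded wellFounded) vector vector-cong public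

    hamel : IsHamelBasis ℝ Basis
    hamel = Basis-hamel λ x → Span-mono
      (λ {y} y∈ → inj₂ (ℝ↔ω₁.to y) , trans (sym (restrict-∈ y∈)) (restrict-cong (real-surjective y)))
      (CantorSet-spans A k gap x)

    Basis⊆CantorSet : Basis ⊆ CantorSet A
    Basis⊆CantorSet {x} (i , x≈ , new) = case (dec (CantorSet A ([ point , real ]′ i)))
      where
      case : Dec (CantorSet A ([ point , real ]′ i)) → CantorSet A x
      case (yes y∈) = CantorSet-resp (sym (trans x≈ (restrict-∈ y∈))) y∈
      case (no y∉)  = ⊥-elim (new (span-0 (restrict-∉ y∉)))

    -- Only earlier points precede an index of the left copy, and a candidate lies outside their
    -- span.
    point∈Basis : ∀ w → Candidate w (Earlier w) (point w) → Basis (point w)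
    point∈Basis w ((d , supp , x≈ , _) , new) = inj₁ w , sym same , λ x∈ → new (Span-resp same (Span-bind earlier x∈))
      where
      same : vector (inj₁ w) ≈ point w
      same = restrict-∈ (d , supp , x≈)

      earlier : Before (inj₁ w) ⊆ Span (Earlier w)
      earlier (inj₁ β , ₁∼₁ β<w , x≈) = Span-resp (sym x≈) (restrict-Span (β , β<w , refl))

    -- A basis element outside a light union of cylinders

    append : (ℕ → List (List Bool)) → ℕ → List (List Bool)
    append L zero    = []
    append L (suc N) = L N ++ append L N

    ∈-append : ∀ L i {τ} → τ ∈ˡ L i → τ ∈ˡ append L (suc i)
    ∈-append L i τ∈ = ∈-++⁺ˡ τ∈

    total-append-++ : ∀ L L′ N → total 0 (append (λ i → L i ++ L′ i) N) ≈ total 0 (append L N) + total 0 (append L′ N)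
    total-append-++ L L′ zero    = sym (+-identityˡ 0#)
    total-append-++ L L′ (suc N) = trans (total-++ 0 (L N ++ L′ N) _)
      (trans (+-cong (total-++ 0 (L N) (L′ N)) (total-append-++ L L′ N))
      (trans (solve 4 (λ a b c d → (a :+ b) :+ (c :+ d) := (a :+ c) :+ (b :+ d)) refl
               (total 0 (L N)) (total 0 (L′ N)) (total 0 (append L N)) (total 0 (append L′ N)))
             (+-cong (sym (total-++ 0 (L N) (append L N))) (sym (total-++ 0 (L′ N) (append L′ N))))))

    five*h≤h : ∀ n → five * h (suc (suc (suc n))) ≤ h n
    five*h≤h n = ≤-certificate (*-nonNeg (+-nonNeg ℝ 0≤1 (+-nonNeg ℝ 0≤1 0≤1)) (0≤h (3 ℕ.+ n)))
      (trans (+-congʳ (sym eight)) (solve 1 (λ x → (((x :+ x) :+ (x :+ x)) :+ ((x :+ x) :+ (x :+ x))) :-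
         ((con (+ 1) :+ (con (+ 1) :+ (con (+ 1) :+ (con (+ 1) :+ con (+ 1))))) :* x) := (con (+ 1) :+ (con (+ 1) :+ con (+ 1))) :* x) refl (h (3 ℕ.+ n))))
      where
      eight : ((h (3 ℕ.+ n) + h (3 ℕ.+ n)) + (h (3 ℕ.+ n) + h (3 ℕ.+ n))) + ((h (3 ℕ.+ n) + h (3 ℕ.+ n)) + (h (3 ℕ.+ n) + h (3 ℕ.+ n))) ≈ h n
      eight = trans (+-cong four four) (h-split n)
        where
        four : (h (3 ℕ.+ n) + h (3 ℕ.+ n)) + (h (3 ℕ.+ n) + h (3 ℕ.+ n)) ≈ h (suc n)
        four = trans (+-cong (h-split (2 ℕ.+ n)) (h-split (2 ℕ.+ n))) (h-split (suc n))

    -- The tail `h (suc N)` of the series 1/4 + 1/8 + ... stays on the left: it serves the induction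
    -- and keeps every stage strictly below 1/2.
    geometric : ∀ (L : ℕ → List (List Bool)) → (∀ i → total 0 (L i) ≤ h (2 ℕ.+ i)) → ∀ N → total 0 (append L N) + h (suc N) ≤ h 1
    geometric L small zero    = ≤.reflexive (+-identityˡ _)
    geometric L small (suc N) = ≤.trans (≤.≤-respˡ-≈ (+-congʳ (sym (total-++ 0 (L N) (append L N))))
        (≤.≤-respʳ-≈ (trans (solve 2 (λ x y → (x :+ y) :+ x := y :+ (x :+ x)) refl (h (2 ℕ.+ N)) (total 0 (append L N))) (+-congˡ (h-split (suc N))))
          (+-mono-≤ (+-mono-≤ (small N) ≤.refl) ≤.refl)))
      (geometric L small N)

    abstract
      -- The point whose index codes the words of `L` escapes, once a candidate is known to exist.
      -- For this, words around the elements of the earlier span are added to `L`; they weigh less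
      -- than the remaining 1/2.
      Basis-escapes : (L : ℕ → List (List Bool)) → (∀ N → total 0 (append L N) ≤ h 1) →
        ∃[ x ] Basis x × ∃[ d ] x ≈ val d × SupportedOn A d × (∀ i τ → τ ∈ˡ L i → ¬ OccursAt 0 τ d)
      Basis-escapes L light =
        let (d , supp , x≈ , esc) , _ = cand
        in point w , point∈Basis w cand , d , x≈ , supp , λ i τ τ∈ occ → esc τ occ (proj₂ family≐ (i , τ , τ∈ , ≡.refl))
        where
        codes : Pred ℕ 0ℓ
        codes n = ∃[ i ] ∃[ τ ] τ ∈ˡ L i × n ≡ encodeBits τ

        w : W.Carrier
        w = proj₁ (family-surjective codes)

        family≐ : family w ≐ codes
        family≐ = proj₂ (family-surjective codes)

        z : ℕ → Carrier
        z = spanEnumeration (earlierEnumeration w)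

        level : ℕ → ℕ
        -- A window weighs at most 5 · 2^(-5 - i) ≤ 2^(-2 - i), the bound required by `geometric`.
        level i = proj₁ (unbounded (5 ℕ.+ i))

        at : ℕ → Pred Digits 0ℓ
        at i d = val d ≈ z i

        extra : ℕ → List (List Bool)
        extra i = cylinders (level i) (at i)

        extra-small : ∀ i → total 0 (extra i) ≤ h (2 ℕ.+ i)
        extra-small i = ≤.trans (total-cylinders (level i) (at i))
          (≤.trans (*-monoˡ-≤ five 0≤five
                     (h-anti-≤ (proj₂ (unbounded (5 ℕ.+ i)))))
                   (five*h≤h (2 ℕ.+ i)))

        all : ℕ → List (List Bool)
        all i = L i ++ extra i

        all-light : Light 0 (append all)
        all-light = (λ N → all N , ≡.refl) , λ N 1≤ → <⇒≱ (0<h (suc N)) (≤-certificate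
          (+-nonNeg ℝ (+-nonNeg ℝ (0≤y-x (light N)) (0≤y-x (geometric extra extra-small N)))
            (0≤y-x (≤.≤-respʳ-≈ (total-append-++ L extra N) (≤.≤-respˡ-≈ (sym (h-split 0)) 1≤))))
          (solve 4 (λ a b c e → con (+ 0) :- c := ((e :- a) :+ (e :- (b :+ c))) :+ ((a :+ b) :- (e :+ e))) refl
            (total 0 (append L N)) (total 0 (append extra N)) (h (suc N)) (h 1)))

        e : Digits
        e = avoiding (append all) all-light

        avoids : ∀ i τ → τ ∈ˡ all i → ¬ OccursAt 0 τ e
        avoids i τ τ∈ = avoiding-avoids (append all) all-light {N = suc i} (∈-append all i τ∈)

        fresh : ¬ Span (Earlier w) (val e)
        fresh e∈ =
          let i , e≈ = Span-enumerable (earlierEnumeration w) (earlier-enumerable w) (val e) e∈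
              τ , τ∈ , occ = cylinders-cover (level i) (at i)
                -- A real may have two expansions, with different prefixes; the window catches both
                -- since their values agree.
                (λ p q → ≤.trans (≤.reflexive (trans p (sym q))) (x≤x+y (0≤h (level i)))) e≈
          in avoids i τ (∈-++⁺ʳ (L i) τ∈) occ

        escapes : Escapes (family w) (val e)
        escapes = e , avoiding-supported (append all) all-light , refl , λ τ occ p → no-code τ occ (proj₁ family≐ p)
          where
          no-code : ∀ τ → OccursAt 0 τ e → ¬ codes (encodeBits τ)
          no-code τ occ (i , σ , σ∈ , eq) =
            avoids i τ (∈-++⁺ˡ (≡.subst (_∈ˡ L i) (≡.sym (encodeBits-injective τ σ eq)) σ∈)) occ

        cand : Candidate w (Earlier w) (point w)
        -- The element `val e` only witnesses that candidates exist; the basis element is the one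
        -- chosen at `w`.
        cand = point-candidate w (val e , escapes , fresh)

    -- Lower bound for the dimension

    finite : [0,∞] ℝ → Carrier
    finite (fin x _) = x
    finite ∞         = 0#

    finiteSum : (ℕ → [0,∞] ℝ) → ℕ → Carrier
    finiteSum c zero    = 0#
    finiteSum c (suc n) = finiteSum c n + finite (c n)

    partialSum-finite : ∀ {c b} {0≤b : 0# ≤ b} N → _≤∞_ ℝ (partialSum ℝ c N) (fin b 0≤b) →
      ∃[ p ] partialSum ℝ c N ≡ fin (finiteSum c N) p
    partialSum-finite zero le = ≤.refl , ≡.refl
    partialSum-finite {c} {0≤b = 0≤b} (suc N) le = go (partialSum ℝ c N) (c N) ≡.refl ≡.refl le
      where
      go : ∀ e f → partialSum ℝ c N ≡ e → c N ≡ f → _≤∞_ ℝ (_+∞_ ℝ e f) (fin _ 0≤b) →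
           ∃[ p ] _+∞_ ℝ e f ≡ fin (finiteSum c N + finite f) p
      go (fin x p) (fin y q) eq _ (fin≤fin x+y≤b)
        with partialSum-finite {c} {0≤b = ≤.trans (+-nonNeg ℝ p q) x+y≤b} N
               (≡.subst (λ e → _≤∞_ ℝ e (fin _ _)) (≡.sym eq) (fin≤fin (≤.trans (x≤x+y q) x+y≤b)))
      ... | r , eq′ with ≡.trans (≡.sym eq) eq′
      ... | ≡.refl = +-nonNeg ℝ p q , ≡.refl

    term-finite : ∀ {c b} {0≤b : 0# ≤ b} N → _≤∞_ ℝ (partialSum ℝ c (suc N)) (fin b 0≤b) → ∃[ p ] c N ≡ fin (finite (c N)) p
    term-finite {c} N le = go (partialSum ℝ c N) (c N) le
      where
      go : ∀ {b} {0≤b : 0# ≤ b} e f → _≤∞_ ℝ (_+∞_ ℝ e f) (fin b 0≤b) → ∃[ p ] f ≡ fin (finite f) p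
      go (fin x p) (fin y q) _ = q , ≡.refl

    four : Carrier → Carrier
    four x = (x + x) + (x + x)

    four-h : ∀ n → four (h (2 ℕ.+ n)) ≈ h n
    four-h n = trans (+-cong (h-split (suc n)) (h-split (suc n))) (h-split n)

    four-mono : ∀ {x y} → x ≤ y → four x ≤ four y
    four-mono x≤y = +-mono-≤ (+-mono-≤ x≤y x≤y) (+-mono-≤ x≤y x≤y)

    -- Stopping the search at depth `N` accommodates `d ≈ 0#`, which has no dyadic scale.
    scale : ∀ d → d ≤ 1# → ∀ N → d ≤ h N ⊎ (∃[ n ] d ≤ h n × h (suc n) ≤ d)
    scale d d≤1 zero = inj₁ d≤1
    scale d d≤1 (suc N) with d ≤? h (suc N)
    ... | yes le = inj₁ le
    ... | no d≰ = [ (λ le → inj₂ (N , le , ≰⇒≥ d≰)) , inj₂ ]′ (scale d d≤1 N)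

    module _ {s t} (s≤1 : s ≤ 1#) (dense : ∀ n → s * ι n ≤ ι (suc (count A n)))
             (0≤t : 0# ≤ t) (t≤s : t ≤ s) where

      -- t (n + 1) ≤ s n + 1 ≤ count + 2. Hence a diameter of at least 2^(-n - 1) has t-th power at
      -- least a quarter of the mass of a cylinder of length `n`.
      exponent : ∀ n → t * ι (suc n) ≤ ι (2 ℕ.+ count A n)
      exponent n = ≤-certificate
        (+-nonNeg ℝ (+-nonNeg ℝ (*-nonNeg (0≤ι (suc n)) (0≤y-x t≤s)) (0≤y-x s≤1)) (0≤y-x (dense n)))
        (solve 4 (λ s t n c → (con (+ 1) :+ (con (+ 1) :+ c)) :- t :* (con (+ 1) :+ n) :=
           ((con (+ 1) :+ n) :* (s :- t) :+ (con (+ 1) :- s)) :+ ((con (+ 1) :+ c) :- s :* n)) refl s t (ι n) (ι (count A n)))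

      module _ {U : Pred Carrier 0ℓ} {γ d} {0≤γ : 0# ≤ γ} {0≤d : 0# ≤ d} (d≤1 : d ≤ 1#)
               (diam : IsDiameter ℝ U (fin d 0≤d)) (pow : IsDiameterPower ℝ U t (fin γ 0≤γ)) where

        -- The term `h i` pays for sets without a usable scale, empty or of tiny diameter, which are
        -- given cylinders of mass at most `h i`.
        Level : ℕ → ℕ → Set
        Level i n = (∀ x y → U x → U y → x ≤ y + h n) × h (count A n) ≤ four γ + h i

        0≤four-γ : 0# ≤ four γ
        0≤four-γ = +-nonNeg ℝ (+-nonNeg ℝ 0≤γ 0≤γ) (+-nonNeg ℝ 0≤γ 0≤γ)

        deep : ∀ i n → i ℕ.≤ count A n → h (count A n) ≤ four γ + h i
        deep i n i≤ = ≤.trans (h-anti-≤ i≤) (≤.≤-respʳ-≈ (+-comm _ _) (x≤x+y 0≤four-γ))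

        within : ∀ n → d ≤ h n → ∀ x y → U x → U y → x ≤ y + h n
        within n d≤h x y Ux Uy = ≤.trans (diameter-bound {U} {d} {0≤d} diam Ux Uy) (+-mono-≤ ≤.refl d≤h)

        matched : ∃ U → ∀ i n → h (suc n) ≤ d → h (count A n) ≤ four γ + h i
        matched inhabited i n h≤d =
          let z , power , h≤z = power-lower {d} {t} {suc n} {2 ℕ.+ count A n} 0≤d d≤1 0≤t h≤d (exponent n)
              0≤z = ≤.trans (0≤h (2 ℕ.+ count A n)) h≤z
              z≤γ = fin≤fin⁻¹ (proj₁ pow (fin z 0≤z) (inhabited , d , 0≤d , z , 0≤z , diam , power , ≡.refl))
          in ≤.trans (≤.≤-respˡ-≈ (four-h (count A n)) (four-mono (≤.trans h≤z z≤γ))) (x≤x+y (0≤h i))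

        abstract
          level-exists : ∀ i → ∃ (Level i)
          level-exists i = go (dec (∃ U)) (unbounded i)
            where
            go : Dec (∃ U) → ∃[ n ] i ℕ.≤ count A n → ∃ (Level i)
            go (no none) (n , i≤) = n , (λ x y Ux _ → ⊥-elim (none (x , Ux))) , deep i n i≤
            go (yes inhabited) (n , i≤) =
              [ (λ d≤h → n , within n d≤h , deep i n i≤)
              , (λ (m , d≤h , h≤d) → m , within m d≤h , matched inhabited i m h≤d) ]′ (scale d d≤1 n)

      -- The five cylinders for the i-th set weigh at most 20 γᵢ + 5 · 2^(-6 - i). The first terms
      -- sum to at most 20 · 2⁻⁷ ≤ 1/4 and the second to less than 1/4, so by `Basis-escapes` some
      -- basis element is left uncovered.
      small-cover-impossible : ∀ {U c} → IsCover ℝ Basis 1# U → (∀ i → IsDiameterPower ℝ (U i) t (c i)) →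
        ¬ (∀ N → _≤∞_ ℝ (partialSum ℝ c N) (fin (h 7) (0≤h 7)))
      small-cover-impossible {U} {c} (covers , diams) powers small = contradiction
        where
        γ : ℕ → Carrier
        γ i = finite (c i)

        0≤γ : ∀ i → 0# ≤ γ i
        0≤γ i = proj₁ (term-finite {c} i (small (suc i)))

        pow : ∀ i → IsDiameterPower ℝ (U i) t (fin (γ i) (0≤γ i))
        pow i = ≡.subst (IsDiameterPower ℝ (U i) t) (proj₂ (term-finite {c} i (small (suc i)))) (powers i)

        levels : ∀ i → ∃[ n ] (∀ x y → U i x → U i y → x ≤ y + h n) × h (count A n) ≤ four (γ i) + h (6 ℕ.+ i)
        levels i = let d , 0≤d , diam , d≤1 = diams i in
          level-exists {U i} {γ i} {d} {0≤γ i} {0≤d} d≤1 diam (pow i) (6 ℕ.+ i)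

        V : ℕ → Pred Digits 0ℓ
        V i e = ∃[ x ] U i x × x ≈ val e

        L : ℕ → List (List Bool)
        L i = cylinders (proj₁ (levels i)) (V i)

        L-small : ∀ i → total 0 (L i) ≤ five * four (γ i) + h (3 ℕ.+ i)
        L-small i = ≤.trans (total-cylinders (proj₁ (levels i)) (V i))
          (≤.trans (*-monoˡ-≤ five 0≤five (proj₂ (proj₂ (levels i))))
          (≤.≤-respˡ-≈ (sym (distribˡ _ _ _)) (+-mono-≤ ≤.refl (five*h≤h (3 ℕ.+ i)))))

        sum-small : ∀ N → total 0 (append L N) + h (2 ℕ.+ N) ≤ five * four (finiteSum c N) + h 2
        sum-small zero = +-mono-≤ (*-nonNeg 0≤five (≤.reflexive (sym (trans (+-cong (+-identityˡ 0#) (+-identityˡ 0#)) (+-identityˡ 0#))))) ≤.refl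
        sum-small (suc N) = ≤-certificate (+-nonNeg ℝ (0≤y-x (L-small N)) (0≤y-x (≤.≤-respˡ-≈ (+-congˡ (sym (h-split (2 ℕ.+ N)))) (sum-small N))))
          (trans (+-congˡ (-‿cong (+-congʳ (total-++ 0 (L N) (append L N)))))
            (rearrange five (γ N) (finiteSum c N) (h 2) (total 0 (L N)) (total 0 (append L N)) (h (3 ℕ.+ N))))
          where
          rearrange : ∀ f g S H x y η → (f * four (S + g) + H) - ((x + y) + η) ≈
                      ((f * four g + η) - x) + ((f * four S + H) - (y + (η + η)))
          rearrange = solve 7 (λ f g S H x y η →
            (f :* (((S :+ g) :+ (S :+ g)) :+ ((S :+ g) :+ (S :+ g))) :+ H) :- ((x :+ y) :+ η) :=
            ((f :* ((g :+ g) :+ (g :+ g)) :+ η) :- x) :+ ((f :* ((S :+ S) :+ (S :+ S)) :+ H) :- (y :+ (η :+ η)))) refl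

        light : ∀ N → total 0 (append L N) ≤ h 1
        light N = ≤.trans (x≤x+y (0≤h (2 ℕ.+ N))) (≤.trans (sum-small N) (≤.≤-respʳ-≈ (h-split 1)
          (+-mono-≤ (≤.trans (*-monoˡ-≤ five 0≤five (≤.≤-respʳ-≈ (four-h 5) (four-mono Σ≤))) (five*h≤h 2)) ≤.refl)))
          where
          Σ≤ : finiteSum c N ≤ h 7
          Σ≤ = fin≤fin⁻¹ {p = proj₁ (partialSum-finite {c} N (small N))}
                 (≡.subst (λ e → _≤∞_ ℝ e (fin (h 7) (0≤h 7))) (proj₂ (partialSum-finite {c} N (small N))) (small N))

        V-small : ∀ i {d e} → V i d → V i e → val d ≤ val e + h (proj₁ (levels i))
        V-small i (x , Ux , x≈) (y , Uy , y≈) = ≤.≤-respˡ-≈ x≈ (≤.≤-respʳ-≈ (+-congʳ y≈) (proj₁ (proj₂ (levels i)) x y Ux Uy))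

        contradiction : ⊥
        contradiction =
          let x , x∈ , e , x≈ , _ , avoids = Basis-escapes L light
              i , Ux = covers x∈
              τ , τ∈ , occurs = cylinders-cover (proj₁ (levels i)) (V i) (V-small i) (x , Ux , x≈)
          in avoids i τ τ∈ occurs

      CoverSum : Pred ([0,∞] ℝ) (lsuc 0ℓ)
      CoverSum e = Σ[ U ∈ (ℕ → Pred Carrier 0ℓ) ] Σ[ c ∈ (ℕ → [0,∞] ℝ) ]
        IsCover ℝ Basis 1# U × (∀ i → IsDiameterPower ℝ (U i) t (c i)) × IsSeriesSum ℝ c e

      coverSum-lower : IsLowerBound (_≤∞_ ℝ) CoverSum (fin (h 7) (0≤h 7))
      coverSum-lower e (U , c , cover , powers , (partial≤ , _)) =
        [ (λ le → le)
        , (λ e≤ → ⊥-elim (small-cover-impossible {U} {c} cover powers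
                            λ N → ≤∞-trans (partial≤ (partialSum ℝ c N) (N , ≡.refl)) e≤)) ]′
        (≤∞-total (fin (h 7) (0≤h 7)) e)

      -- The single scale δ = 1 suffices: its premeasure is at least 2⁻⁷, and the measure is an
      -- upper bound of the premeasures.
      measure-nonzero : ¬ IsHausdorffMeasure ℝ Basis t (0∞ ℝ)
      measure-nonzero (ub , _) =
        let e , premeasure = infimum-∞ CoverSum
        in <⇒≱ (0<h 7) (fin≤fin⁻¹ {p = 0≤h 7} {q = ≤.refl} (≤∞-trans (proj₂ premeasure (fin (h 7) (0≤h 7)) coverSum-lower)
             (ub e (1# , 0<1 , premeasure))))

  ∞≰fin : ∀ {x p} → ¬ _≤∞_ ℝ ∞ (fin x p)
  ∞≰fin ()

  -- The digit set of density `s` and the conclusion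

  module Conclusion (ac : ∀ a b r → AxiomOfChoice a b r) (s : Carrier) (0<s : 0# < s) (s≤1 : s ≤ 1#) where

    admit : ℕ → ℕ → Bool
    admit n c = does (ι (suc c) ≤? s * ι (suc n))

    admitted : ℕ → ℕ
    admitted zero    = 0
    admitted (suc n) = admitted n ℕ.+ bit (admit n (admitted n))

    -- The set of all n with ⌊s n⌋ < ⌊s (n + 1)⌋.
    beatty : Digits
    beatty n = admit n (admitted n)

    count-beatty : ∀ n → count beatty n ≡ admitted n
    count-beatty zero    = ≡.refl
    count-beatty (suc n) = ≡.cong (ℕ._+ bit (beatty n)) (count-beatty n)

    -- As `s ≤ 1#`, the product s n grows by at most 1 per step, so one digit can keep the count
    -- within the bounds.
    admit-step : ∀ n c → ι c ≤ s * ι n × s * ι n ≤ ι (suc c) →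
      ι (c ℕ.+ bit (admit n c)) ≤ s * ι (suc n) × s * ι (suc n) ≤ ι (suc (c ℕ.+ bit (admit n c)))
    admit-step n c (lo , hi) with ι (suc c) ≤? s * ι (suc n)
    ... | yes le rewrite ℕ.+-comm c 1 = le , ≤-certificate (+-nonNeg ℝ (0≤y-x hi) (0≤y-x s≤1))
            (solve 3 (λ s n c → (con (+ 1) :+ (con (+ 1) :+ c)) :- s :* (con (+ 1) :+ n) := ((con (+ 1) :+ c) :- s :* n) :+ (con (+ 1) :- s)) refl s (ι n) (ι c))
    ... | no nle rewrite ℕ.+-identityʳ c = ≤.trans lo (*-monoˡ-≤ s (proj₁ 0<s) (ι-mono-≤ (ℕ.n≤1+n n))) , ≰⇒≥ nle

    admitted-bounds : ∀ n → ι (admitted n) ≤ s * ι n × s * ι n ≤ ι (suc (admitted n))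
    admitted-bounds zero    = ≤.reflexive (sym (zeroʳ s)) , ≤.trans (≤.reflexive (zeroʳ s)) (0≤ι 1)
    admitted-bounds (suc n) = admit-step n (admitted n) (admitted-bounds n)

    sparse : ∀ n → ι (count beatty n) ≤ s * ι n
    sparse n = ≡.subst (λ c → ι c ≤ s * ι n) (≡.sym (count-beatty n)) (proj₁ (admitted-bounds n))

    dense : ∀ n → s * ι n ≤ ι (suc (count beatty n))
    dense n = ≡.subst (λ c → s * ι n ≤ ι (suc c)) (≡.sym (count-beatty n)) (proj₂ (admitted-bounds n))

    abstract
      multiple : ∀ m → ∃[ n ] ι m ≤ s * ι n
      multiple m = let n , le = archimedean (s ⁻¹ * ι m)
        in n , ≤.≤-respˡ-≈ (trans (sym (*-assoc _ _ _)) (trans (*-congʳ (⁻¹-inverseʳ s (>⇒≉0 0<s))) (*-identityˡ _)))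
                 (*-monoˡ-≤ s (proj₁ 0<s) le)

    unbounded : ∀ i → ∃[ n ] i ℕ.≤ count beatty n
    unbounded i = let n , le = multiple (suc i) in n , ℕ.s≤s⁻¹ (ι-cancel-≤ (≤.trans le (dense n)))

    k : ℕ
    -- With s k ≥ 2, count (n + k) + 1 ≥ s n + s k ≥ count n + 2, so every block of length `k` meets
    -- the set.
    k = proj₁ (multiple 2)

    gap : ∀ n → ∃[ j ] j ℕ.< k × beatty (n ℕ.+ j) ≡ true
    gap n = member-between beatty n k (ℕ.s≤s⁻¹ (ι-cancel-≤ {2 ℕ.+ count beatty n} {suc (count beatty (n ℕ.+ k))}
      (≤.trans (≤-certificate (+-nonNeg ℝ (0≤y-x (sparse n)) (0≤y-x (proj₂ (multiple 2))))
        (trans (+-congʳ (*-congˡ (×-homo-+ 1# n k)))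
          (solve 4 (λ s n k c → s :* (n :+ k) :- (con (+ 1) :+ (con (+ 1) :+ c)) := (s :* n :- c) :+ (s :* k :- (con (+ 1) :+ (con (+ 1) :+ con (+ 0))))) refl
            s (ι n) (ι k) (ι (count beatty n)))))
        (dense (n ℕ.+ k)))))

    module _ (ch : ContinuumHypothesis ℝ) where
      open Construction ac ch beatty unbounded k gap public using (Basis; hamel; Basis⊆CantorSet)

      -- Every exponent up to `s` is excluded directly, which avoids comparing Hausdorff measures of
      -- different exponents.
      s≤measure-zero : IsLowerBound (_≤∞_ ℝ) (λ e → ∃[ t ] ∃[ 0≤t ] IsHausdorffMeasure ℝ Basis t (0∞ ℝ) × e ≡ fin t 0≤t) (fin s (proj₁ 0<s))
      s≤measure-zero _ (t , 0≤t , null , ≡.refl) = go (dec (s ≤ t))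
        where
        go : Dec (s ≤ t) → _≤∞_ ℝ (fin s (proj₁ 0<s)) (fin t 0≤t)
        go (yes s≤t) = fin≤fin s≤t
        go (no s≰t)  = ⊥-elim (Construction.measure-nonzero ac ch beatty unbounded k gap s≤1 dense 0≤t (≰⇒≥ s≰t) null)

      -- The exponent `s` itself is not null, so the infimum is approached through `s + h n`.
      null-above : ∀ n → IsHausdorffMeasure ℝ Basis (s + h n) (0∞ ℝ)
      null-above n = UpperBound.measure-zero beatty sparse (+-nonNeg ℝ (proj₁ 0<s) (0≤h n))
        (λ le → <⇒≱ (0<h n) (≤-certificate (0≤y-x le) (solve 2 (λ s x → con (+ 0) :- x := s :- (s :+ x)) refl s (h n))))
        Basis⊆CantorSet

      NullExponent : Pred ([0,∞] ℝ) (lsuc 0ℓ)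
      NullExponent e = ∃[ t ] ∃[ 0≤t ] IsHausdorffMeasure ℝ Basis t (0∞ ℝ) × e ≡ fin t 0≤t

      0≤s+h : ∀ n → 0# ≤ s + h n
      0≤s+h n = +-nonNeg ℝ (proj₁ 0<s) (0≤h n)

      above : ∀ n → NullExponent (fin (s + h n) (0≤s+h n))
      above n = s + h n , 0≤s+h n , null-above n , ≡.refl

      greatest : ∀ l → IsLowerBound (_≤∞_ ℝ) NullExponent l → _≤∞_ ℝ l (fin s (proj₁ 0<s))
      greatest (fin x 0≤x) lb = fin≤fin (≤-from-h λ n → fin≤fin⁻¹ {x} {s + h n} {0≤x} {0≤s+h n} (lb (fin (s + h n) (0≤s+h n)) (above n)))
      greatest ∞ lb = ⊥-elim (∞≰fin {s + h 0} {0≤s+h 0} (lb (fin (s + h 0) (0≤s+h 0)) (above 0)))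

      dimension : IsHausdorffDimension ℝ Basis (fin s (proj₁ 0<s))
      dimension = s≤measure-zero , greatest

theorem3p1 : (∀ ℓ → ExcludedMiddle ℓ) →
    (∀ a b r → AxiomOfChoice a b r) →
    (ℝ : RealField) →
    let open RealField ℝ in
    ContinuumHypothesis ℝ →
    (s : Carrier) (0<s : 0# < s) → s ≤ 1# →
    Σ[ B ∈ Pred Carrier 0ℓ ]
    IsHamelBasis ℝ B × IsHausdorffDimension ℝ B (fin s (proj₁ 0<s))
theorem3p1 lem ac ℝ ch s 0<s s≤1 = Basis ch , hamel ch , dimension ch
  where open Development.Conclusion lem ℝ ac s 0<s s≤1
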